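{- (Termination.) Programs typable in the stratified affine-intuitionistic type and effect system terminate: if $R;\Gamma\vdash P:(\alpha,e)$ is derivable in the stratified affine-intuitionistic type and effect system, then all reduction sequences starting from $P$ are finite.
   Context: **Syntax of programs.** Let $x,y,\ldots$ range over variables. Values: $V::= * \mid x\mid \lambda x.M\mid\, !V$. Terms: $M::= V\mid MM\mid\, !M\mid \mathsf{let}\ !x=M\ \mathsf{in}\ M\mid \nu x\,M\mid \mathsf{set}(x,V)\mid \mathsf{pset}(x,V)\mid \mathsf{get}(x)\mid (M\mid M)$. Stores: $S::=(x\leftarrow V)\mid (x\Leftarrow V)\mid (S\mid S)$. Programs: $P::=M\mid S\mid (P\mid P)\mid \nu x\,P$. Evaluation contexts: $E::=[\ ]\mid EM\mid VE\mid\, !E\mid \mathsf{let}\ !x=E\ \mathsf{in}\ M$. Static contexts: $C::=[\ ]\mid (C\mid P)\mid (P\mid C)\mid \nu x\,C$. In $\lambda x.M$, $\nu x\,M$, $\mathsf{let}\ !x=N\ \mathsf{in}\ M$ (and $\nu x\,P$) the variable $x$ is bound in $M$ (resp. $P$). $[V/x]$ is capture-avoiding substitution, $FV$ denotes free variables. **Operational semantics.** Structural equivalence $\equiv$ is the least equivalence relation preserved by static contexts and containing $\alpha$-renaming, $P\mid P'\equiv P'\mid P$, $(P\mid P')\mid P''\equiv P\mid(P'\mid P'')$, $\nu x\,P\mid P'\equiv \nu x\,(P\mid P')$ if $x\notin FV(P')$, and $E[\nu x\,M]\equiv \nu x\,E[M]$ if $x\notin FV(E)$. Basic reductions: $E[(\lambda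 x.M)V]\to E[[V/x]M]$; $E[\mathsf{let}\ !x=\,!V\ \mathsf{in}\ M]\to E[[V/x]M]$; $E[\mathsf{set}(x,V)]\to E[*]\mid (x\leftarrow V)$; $E[\mathsf{pset}(x,V)]\to E[*]\mid (x\Leftarrow V)$; $E[\mathsf{get}(x)]\mid (x\leftarrow V)\to E[V]$; $E[\mathsf{get}(x)]\mid (x\Leftarrow\,!V)\to E[!V]\mid (x\Leftarrow\,!V)$. Reduction applies these modulo $\equiv$ and inside any static context $C$. **Types and effects.** Let $r$ range over regions; each region is either volatile, $\mathcal V(r)$, or persistent, $\mathcal P(r)$. Effects $e,e',\ldots$ are finite sets of regions. Types: $\alpha::=\mathbf B\mid A$. Value-types: $A::=\mathbf 1\mid A\stackrel{e}{\multimap}\alpha\mid\, !A\mid \mathsf{Reg}_rA$. **Usages.** On $\{0,1,\infty\}$ let $\uplus$ be the partial operation with $x\uplus 0=0\uplus x=x$, $\infty\uplus\infty=\infty$, undefined otherwise. Variable usages are $u\in\{1,\infty\}$. Region usages $U=[v,v']$ ($v$: write, $v'$: read) belong to one of the three sets $\{[\infty,\infty]\}$, $\{[1,\infty],[0,\infty]\}$, $\{[0,0],[1,0],[0,1],[1,1]\}$; $U_1\uplus U_2$ is component-wise, defined iff $U_1,U_2$ are in the same set and the component-wise sums are defined. Each set has a neutral usage. **Contexts.** A context $\Gamma=x_1:(u_1,A_1),\ldots,x_n:(u_n,A_n)$ has distinct variables; a region context $R=r_1:(U_1,A_1),\ldots,r_n:(U_n,A_n)$ has distinct regions; $dom$ is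 the set of variables (regions) listed. $\Gamma_1\uplus\Gamma_2$ is the union in which a variable occurring in both must have the same type, its usages being added (defined only if these sums are). $R_1\uplus R_2$ is the same for regions, and requires $dom(R_1)=dom(R_2)$ (missing regions are implicitly added with the neutral usage of the relevant set). **Stratified formation rules.** $\emptyset\vdash$; $R,r:(U,A)\vdash$ if $R\vdash A$ and $r\notin dom(R)$; $R\vdash\mathbf 1$ and $R\vdash\mathbf B$ if $R\vdash$; $R\vdash\,!A$ if $R\vdash A$; $R\vdash(A\stackrel{e}{\multimap}\alpha)$ if $R\vdash A$, $R\vdash\alpha$ and $e\subseteq dom(R)$; $R\vdash\mathsf{Reg}_rA$ if $R\vdash$ and $r:(U,A)\in R$ for some $U$; $R\vdash(\alpha,e)$ if $R\vdash\alpha$ and $e\subseteq dom(R)$. $R\vdash\Gamma$ if $R\vdash A$ for all $x:(u,A)\in\Gamma$. **Subtyping.** $R\vdash\alpha\le\alpha$; $R\vdash\,!A\le\,!A'$ if $R\vdash A\le A'$; $R\vdash(A\stackrel{e}{\multimap}\alpha)\le(A'\stackrel{e'}{\multimap}\alpha')$ if $e\subseteq e'\subseteq dom(R)$, $R\vdash A'\le A$, $R\vdash\alpha\le\alpha'$; $R\vdash(\alpha,e)\le(\alpha',e')$ if $e\subseteq e'\subseteq dom(R)$ and $R\vdash\alpha\le\alpha'$. **Affinity.** $\mathit{aff}(x:(u,A))$ iff $u=1$. $\mathit{aff}(r:([v,v'],A))$ iff $1\in\{v,v'\}$ or ($\mathcal V(r)$ and $v'\neq0$). $\mathit{aff}(R;\Gamma)$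 (resp. $\mathit{saff}(R;\Gamma)$) iff $\mathit{aff}$ holds for at least one (resp. all) hypotheses of $R;\Gamma$. **Typing rules** (premises $\Rightarrow$ conclusion) for $R;\Gamma\vdash P:(\alpha,e)$: 1. $R\vdash\Gamma$, $x:(u,A)\in\Gamma$ $\Rightarrow$ $R;\Gamma\vdash x:(A,\emptyset)$. 2. $R\vdash\Gamma$ $\Rightarrow$ $R;\Gamma\vdash *:(\mathbf 1,\emptyset)$. 3. $R;\Gamma,x:(1,A)\vdash M:(\alpha,e)$ $\Rightarrow$ $R;\Gamma\vdash\lambda x.M:(A\stackrel{e}{\multimap}\alpha,\emptyset)$. 4. $R_1;\Gamma_1\vdash M:(A\stackrel{e}{\multimap}\alpha,e')$, $R_2;\Gamma_2\vdash N:(A,e'')$ $\Rightarrow$ $R_1\uplus R_2;\Gamma_1\uplus\Gamma_2\vdash MN:(\alpha,e\cup e'\cup e'')$. 5. $R\uplus R'\vdash\Gamma\uplus\Gamma'$, $\mathit{saff}(R';\Gamma')$, $R;\Gamma\vdash M:(A,e)$, $\neg\mathit{aff}(R;\Gamma)$ $\Rightarrow$ $R\uplus R';\Gamma\uplus\Gamma'\vdash\,!M:(!A,e)$. 6. $R_1;\Gamma_1\vdash M:(!A,e)$, $R_2;\Gamma_2,x:(\infty,A)\vdash N:(\alpha,e')$ $\Rightarrow$ $R_1\uplus R_2;\Gamma_1\uplus\Gamma_2\vdash\mathsf{let}\ !x=M\ \mathsf{in}\ N:(\alpha,e\cup e')$. 7. $R;\Gamma,x:(u,\mathsf{Reg}_rA)\vdash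 P:(\alpha,e)$ $\Rightarrow$ $R;\Gamma\vdash\nu x\,P:(\alpha,e)$. 8. $R\vdash\Gamma$, $x:(u,\mathsf{Reg}_rA)\in\Gamma$, $r:([v,v'],A)\in R$, $v'\neq0$ $\Rightarrow$ $R;\Gamma\vdash\mathsf{get}(x):(A,\{r\})$. 9. $\Gamma=x:(u,\mathsf{Reg}_rA)\uplus\Gamma'$, $\mathcal V(r)$, $R=r:([v,v'],A)\uplus R'$, $v\neq0$, $R\vdash\Gamma$, $R';\Gamma'\vdash V:(A,\emptyset)$ $\Rightarrow$ $R;\Gamma\vdash\mathsf{set}(x,V):(\mathbf 1,\{r\})$; and, from the same premises, $R;\Gamma\vdash(x\leftarrow V):(\mathbf B,\emptyset)$. 10. $\Gamma=x:(u,\mathsf{Reg}_r\,!A)\uplus\Gamma'$, $\mathcal P(r)$, $R=r:([v,v'],!A)\uplus R'$, $v\neq0$, $R\vdash\Gamma$, $R';\Gamma'\vdash V:(!A,\emptyset)$ $\Rightarrow$ $R;\Gamma\vdash\mathsf{pset}(x,V):(\mathbf 1,\{r\})$; and, from the same premises, $R;\Gamma\vdash(x\Leftarrow V):(\mathbf B,\emptyset)$. 11. $R_1;\Gamma_1\vdash P:(\alpha,e)$, $R_2;\Gamma_2\vdash S:(\mathbf B,\emptyset)$ ($S$ a store) $\Rightarrow$ $R_1\uplus R_2;\Gamma_1\uplus\Gamma_2\vdash(P\mid S):(\alpha,e)$, and symmetrically for $(S\mid P)$. 12. $R_i;\Gamma_i\vdash P_i:(\alpha_i,e_i)$, $P_i$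 not a store ($i=1,2$) $\Rightarrow$ $R_1\uplus R_2;\Gamma_1\uplus\Gamma_2\vdash(P_1\mid P_2):(\mathbf B,e_1\cup e_2)$. 13. $R;\Gamma\vdash M:(\alpha,e)$, $R\vdash(\alpha,e)\le(\alpha',e')$ $\Rightarrow$ $R;\Gamma\vdash M:(\alpha',e')$ ($M$ a term). -}

module Defs where

open import Data.Fin.Base using (Fin; zero; suc)
open import Data.Fin.Subset using (Subset; _∈_; _⊆_; _∪_; ⁅_⁆; ⊥)
open import Data.Maybe.Base using (Maybe; just; nothing; is-just)
open import Data.Nat.Base using (ℕ; suc)
open import Data.Product.Base using (_×_; _,_; ∃)
open import Data.Sum.Base using (_⊎_)
open import Data.Vec.Base using (Vec; _∷_; lookup; map; replicate; _[_]≔_)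
open import Function.Base using (flip)
open import Induction.WellFounded using (Acc)
open import Relation.Binary.PropositionalEquality using (_≡_; _≢_)
open import Relation.Nullary.Negation.Core using (¬_)

private
  variable
    k m n : ℕ

-- Well-scoped de Bruijn expressions, so α-equivalence is equality.  The
-- categories of the grammar overlap (!V is a value and also the term !M
-- with M = V; M ∣ M is a term and a program), hence one type of raw
-- expressions, from which Value, Term, Store and Program below select
-- them.  The first argument of set, pset, get, ← and ⇐ is a raw
-- expression only to make substitution total: the predicates and all the
-- rules accept just a variable there.

infix  9 !_
infixl 8 _·_
infix  6 _←_ _⇐_
infixr 5 _∥_

data Exp (n : ℕ) : Set where
  var  : Fin n → Exp n
  *    : Exp n
  ƛ    : Exp (suc n) → Exp n
  !_   : Exp n → Exp n
  _·_  : Exp n → Exp n → Exp n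
  let! : Exp n → Exp (suc n) → Exp n
  ν    : Exp (suc n) → Exp n
  set  : Exp n → Exp n → Exp n
  pset : Exp n → Exp n → Exp n
  get  : Exp n → Exp n
  _∥_  : Exp n → Exp n → Exp n
  _←_  : Exp n → Exp n → Exp n
  _⇐_  : Exp n → Exp n → Exp n

mutual
  data Value {n} : Exp n → Set where
    var : ∀ x → Value (var x)
    *   : Value *
    ƛ   : ∀ {M} → Term M → Value (ƛ M)
    !_  : ∀ {V} → Value V → Value (! V)

  data Term {n} : Exp n → Set where
    val  : ∀ {V} → Value V → Term V
    _·_  : ∀ {M N} → Term M → Term N → Term (M · N)
    !_   : ∀ {M} → Term M → Term (! M)
    let! : ∀ {M N} → Term M → Term N → Term (let! M N)
    ν    : ∀ {M} → Term M → Term (ν M)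
    set  : ∀ x {V} → Value V → Term (set (var x) V)
    pset : ∀ x {V} → Value V → Term (pset (var x) V)
    get  : ∀ x → Term (get (var x))
    _∥_  : ∀ {M N} → Term M → Term N → Term (M ∥ N)

data Store {n} : Exp n → Set where
  _←_ : ∀ x {V} → Value V → Store (var x ← V)
  _⇐_ : ∀ x {V} → Value V → Store (var x ⇐ V)
  _∥_ : ∀ {S T} → Store S → Store T → Store (S ∥ T)

data Program {n} : Exp n → Set where
  term  : ∀ {M} → Term M → Program M
  store : ∀ {S} → Store S → Program S
  _∥_   : ∀ {P Q} → Program P → Program Q → Program (P ∥ Q)
  ν     : ∀ {P} → Program P → Program (ν P)

extᵣ : (Fin m → Fin n) → Fin (suc m) → Fin (suc n)
extᵣ ρ zero    = zero
extᵣ ρ (suc x) = suc (ρ x)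

rename : (Fin m → Fin n) → Exp m → Exp n
rename ρ (var x)    = var (ρ x)
rename ρ *          = *
rename ρ (ƛ M)      = ƛ (rename (extᵣ ρ) M)
rename ρ (! M)      = ! rename ρ M
rename ρ (M · N)    = rename ρ M · rename ρ N
rename ρ (let! M N) = let! (rename ρ M) (rename (extᵣ ρ) N)
rename ρ (ν M)      = ν (rename (extᵣ ρ) M)
rename ρ (set M N)  = set (rename ρ M) (rename ρ N)
rename ρ (pset M N) = pset (rename ρ M) (rename ρ N)
rename ρ (get M)    = get (rename ρ M)
rename ρ (M ∥ N)    = rename ρ M ∥ rename ρ N
rename ρ (M ← N)    = rename ρ M ← rename ρ N
rename ρ (M ⇐ N)    = rename ρ M ⇐ rename ρ N

extₛ : (Fin m → Exp n) → Fin (suc m) → Exp (suc n)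
extₛ σ zero    = var zero
extₛ σ (suc x) = rename suc (σ x)

subst : (Fin m → Exp n) → Exp m → Exp n
subst σ (var x)    = σ x
subst σ *          = *
subst σ (ƛ M)      = ƛ (subst (extₛ σ) M)
subst σ (! M)      = ! subst σ M
subst σ (M · N)    = subst σ M · subst σ N
subst σ (let! M N) = let! (subst σ M) (subst (extₛ σ) N)
subst σ (ν M)      = ν (subst (extₛ σ) M)
subst σ (set M N)  = set (subst σ M) (subst σ N)
subst σ (pset M N) = pset (subst σ M) (subst σ N)
subst σ (get M)    = get (subst σ M)
subst σ (M ∥ N)    = subst σ M ∥ subst σ N
subst σ (M ← N)    = subst σ M ← subst σ N
subst σ (M ⇐ N)    = subst σ M ⇐ subst σ N

_for-zero : Exp n → Fin (suc n) → Exp n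
(V for-zero) zero    = V
(V for-zero) (suc x) = var x

infix 10 _[_]
_[_] : Exp (suc n) → Exp n → Exp n
M [ V ] = subst (V for-zero) M

mutual
  rename-value : (ρ : Fin m → Fin n) {V : Exp m} → Value V → Value (rename ρ V)
  rename-value ρ (var x) = var (ρ x)
  rename-value ρ *       = *
  rename-value ρ (ƛ M)   = ƛ (rename-term (extᵣ ρ) M)
  rename-value ρ (! V)   = ! rename-value ρ V

  rename-term : (ρ : Fin m → Fin n) {M : Exp m} → Term M → Term (rename ρ M)
  rename-term ρ (val V)    = val (rename-value ρ V)
  rename-term ρ (M · N)    = rename-term ρ M · rename-term ρ N
  rename-term ρ (! M)      = ! rename-term ρ M
  rename-term ρ (let! M N) = let! (rename-term ρ M) (rename-term (extᵣ ρ) N)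
  rename-term ρ (ν M)      = ν (rename-term (extᵣ ρ) M)
  rename-term ρ (set x V)  = set (ρ x) (rename-value ρ V)
  rename-term ρ (pset x V) = pset (ρ x) (rename-value ρ V)
  rename-term ρ (get x)    = get (ρ x)
  rename-term ρ (M ∥ N)    = rename-term ρ M ∥ rename-term ρ N

data ECtx (n : ℕ) : Set where
  □    : ECtx n
  appˡ : ECtx n → ∀ {M : Exp n} → Term M → ECtx n
  appʳ : ∀ {V : Exp n} → Value V → ECtx n → ECtx n
  !_   : ECtx n → ECtx n
  let! : ECtx n → ∀ {M : Exp (suc n)} → Term M → ECtx n

infix 10 _⟦_⟧
_⟦_⟧ : ECtx n → Exp n → Exp n
□              ⟦ M ⟧ = M
appˡ E {N} _   ⟦ M ⟧ = E ⟦ M ⟧ · N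
appʳ {V} _ E   ⟦ M ⟧ = V · E ⟦ M ⟧
(! E)          ⟦ M ⟧ = ! E ⟦ M ⟧
let! E {N} _   ⟦ M ⟧ = let! (E ⟦ M ⟧) N

renameᴱ : (Fin m → Fin n) → ECtx m → ECtx n
renameᴱ ρ □          = □
renameᴱ ρ (appˡ E M) = appˡ (renameᴱ ρ E) (rename-term ρ M)
renameᴱ ρ (appʳ V E) = appʳ (rename-value ρ V) (renameᴱ ρ E)
renameᴱ ρ (! E)      = ! renameᴱ ρ E
renameᴱ ρ (let! E M) = let! (renameᴱ ρ E) (rename-term (extᵣ ρ) M)

-- SCtx m n: the hole is in scope m, the whole in scope n; plugging is
-- capturing.
data SCtx (m : ℕ) : ℕ → Set where
  □    : SCtx m m
  parˡ : SCtx m n → ∀ {P : Exp n} → Program P → SCtx m n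
  parʳ : ∀ {P : Exp n} → Program P → SCtx m n → SCtx m n
  ν    : SCtx m (suc n) → SCtx m n

infix 10 _⟪_⟫
_⟪_⟫ : SCtx m n → Exp m → Exp n
□                ⟪ Q ⟫ = Q
parˡ C {P = P} _ ⟪ Q ⟫ = C ⟪ Q ⟫ ∥ P
parʳ {P = P} _ C ⟪ Q ⟫ = P ∥ C ⟪ Q ⟫
ν C              ⟪ Q ⟫ = ν (C ⟪ Q ⟫)

-- The side conditions x ∉ FV(Q) and x ∉ FV(E) become weakenings.  The
-- axioms apply to raw expressions; on programs they relate only programs.
infix 4 _≋_
data _≋_ : ∀ {n} → Exp n → Exp n → Set where
  refl   : ∀ {n} {P : Exp n} → P ≋ P
  sym    : ∀ {n} {P Q : Exp n} → P ≋ Q → Q ≋ P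
  trans  : ∀ {n} {P Q T : Exp n} → P ≋ Q → Q ≋ T → P ≋ T
  static : ∀ {m n} {P Q : Exp m} (C : SCtx m n) → P ≋ Q → C ⟪ P ⟫ ≋ C ⟪ Q ⟫
  comm   : ∀ {n} (P Q : Exp n) → P ∥ Q ≋ Q ∥ P
  assoc  : ∀ {n} (P Q T : Exp n) → (P ∥ Q) ∥ T ≋ P ∥ (Q ∥ T)
  ν-par  : ∀ {n} (P : Exp (suc n)) Q → ν P ∥ Q ≋ ν (P ∥ rename suc Q)
  ν-eval : ∀ {n} (E : ECtx n) M → E ⟦ ν M ⟧ ≋ ν (renameᴱ suc E ⟦ M ⟧)

infix 4 _↦_ _⟶_
data _↦_ {n : ℕ} : Exp n → Exp n → Set where
  β    : ∀ E {M} {V : Exp n} → Value V →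
         E ⟦ ƛ M · V ⟧ ↦ E ⟦ M [ V ] ⟧
  let! : ∀ E {M} {V : Exp n} → Value V →
         E ⟦ let! (! V) M ⟧ ↦ E ⟦ M [ V ] ⟧
  set  : ∀ E {x} {V : Exp n} → Value V →
         E ⟦ set (var x) V ⟧ ↦ E ⟦ * ⟧ ∥ (var x ← V)
  pset : ∀ E {x} {V : Exp n} → Value V →
         E ⟦ pset (var x) V ⟧ ↦ E ⟦ * ⟧ ∥ (var x ⇐ V)
  get← : ∀ E {x} {V : Exp n} → Value V →
         E ⟦ get (var x) ⟧ ∥ (var x ← V) ↦ E ⟦ V ⟧
  get⇐ : ∀ E {x} {V : Exp n} → Value V →
         E ⟦ get (var x) ⟧ ∥ (var x ⇐ ! V) ↦ E ⟦ ! V ⟧ ∥ (var x ⇐ ! V)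

data _⟶_ {n : ℕ} : Exp n → Exp n → Set where
  red : ∀ {m P P′} {Q Q′ : Exp m} (C : SCtx m n) →
        P ≋ C ⟪ Q ⟫ → Q ↦ Q′ → C ⟪ Q′ ⟫ ≋ P′ → P ⟶ P′

-- Pointwise version of Relation.Binary.Rewriting.StronglyNormalizing:
-- constructively, accessibility says that all reduction sequences from
-- an expression are finite.
Terminating : Exp n → Set
Terminating = Acc (flip _⟶_)

-- Regions are the elements of Fin k for an arbitrary k: no rule creates
-- regions, so a derivation mentions finitely many, and effects get
-- canonical representatives, hence types the intended equality.
data Durability : Set where
  volatile persistent : Durability

Effect : ℕ → Set
Effect = Subset

infixr 7 _⊸[_]_
mutual
  data Type (k : ℕ) : Set where
    𝐁   : Type k
    val : ValType k → Type k

  data ValType (k : ℕ) : Set where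
    𝟏      : ValType k
    _⊸[_]_ : ValType k → Effect k → Type k → ValType k
    !_     : ValType k → ValType k
    Reg    : Fin k → ValType k → ValType k

data Usage : Set where
  𝟎 𝟙 ∞ : Usage

infixl 6 _⊎ᵘ_
_⊎ᵘ_ : Usage → Usage → Maybe Usage
𝟎 ⊎ᵘ u = just u
𝟙 ⊎ᵘ 𝟎 = just 𝟙
𝟙 ⊎ᵘ 𝟙 = nothing
𝟙 ⊎ᵘ ∞ = nothing
∞ ⊎ᵘ 𝟎 = just ∞
∞ ⊎ᵘ 𝟙 = nothing
∞ ⊎ᵘ ∞ = just ∞

data VarUsage : Set where
  𝟙 ∞ : VarUsage

⌊_⌋ : VarUsage → Usage
⌊ 𝟙 ⌋ = 𝟙
⌊ ∞ ⌋ = ∞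

data RegUsage : Set where
  [∞,∞]                   : RegUsage
  [1,∞] [0,∞]             : RegUsage
  [0,0] [1,0] [0,1] [1,1] : RegUsage

write read : RegUsage → Usage
write [∞,∞] = ∞
write [1,∞] = 𝟙
write [0,∞] = 𝟎
write [0,0] = 𝟎
write [1,0] = 𝟙
write [0,1] = 𝟎
write [1,1] = 𝟙
read [∞,∞] = ∞
read [1,∞] = ∞
read [0,∞] = ∞
read [0,0] = 𝟎
read [1,0] = 𝟎
read [0,1] = 𝟙
read [1,1] = 𝟙

-- The neutral usage of the set a region usage belongs to; two region
-- usages are in the same set iff these coincide.
neutral : RegUsage → RegUsage
neutral [∞,∞] = [∞,∞]
neutral [1,∞] = [0,∞]
neutral [0,∞] = [0,∞]
neutral [0,0] = [0,0]
neutral [1,0] = [0,0]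
neutral [0,1] = [0,0]
neutral [1,1] = [0,0]

infix 4 _⊎ʳ_≐_
record _⊎ʳ_≐_ (U₁ U₂ U : RegUsage) : Set where
  field
    same-set  : neutral U₁ ≡ neutral U₂
    sum-write : write U₁ ⊎ᵘ write U₂ ≡ just (write U)
    sum-read  : read U₁ ⊎ᵘ read U₂ ≡ just (read U)

-- Finite partial maps: `nothing` marks a variable or region outside the
-- domain.

VarHyp RegHyp : ℕ → Set
VarHyp k = VarUsage × ValType k
RegHyp k = RegUsage × ValType k

VarCtx : ℕ → ℕ → Set
VarCtx k n = Vec (Maybe (VarHyp k)) n

RegCtx : ℕ → Set
RegCtx k = Vec (Maybe (RegHyp k)) k

singleton : ∀ {A : Set} → Fin n → A → Vec (Maybe A) n
singleton x h = replicate _ nothing [ x ]≔ just h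

infix 4 _∋_⦂_
_∋_⦂_ : ∀ {A : Set} → Vec (Maybe A) n → Fin n → A → Set
Γ ∋ x ⦂ h = lookup Γ x ≡ just h

dom : RegCtx k → Effect k
dom = map is-just

data VarSum {k} : (h₁ h₂ h : Maybe (VarHyp k)) → Set where
  none  : VarSum nothing nothing nothing
  left  : ∀ {h} → VarSum (just h) nothing (just h)
  right : ∀ {h} → VarSum nothing (just h) (just h)
  both  : ∀ {u₁ u₂ u A} → ⌊ u₁ ⌋ ⊎ᵘ ⌊ u₂ ⌋ ≡ just ⌊ u ⌋ →
          VarSum (just (u₁ , A)) (just (u₂ , A)) (just (u , A))

-- In left and right, the region missing on one side is first added there
-- with the same type and the neutral usage.  The predicates aff and saff
-- see only the hypotheses actually present.
data RegSum {k} : (h₁ h₂ h : Maybe (RegHyp k)) → Set where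
  none  : RegSum nothing nothing nothing
  left  : ∀ {U₁ U A} → U₁ ⊎ʳ neutral U₁ ≐ U →
          RegSum (just (U₁ , A)) nothing (just (U , A))
  right : ∀ {U₂ U A} → neutral U₂ ⊎ʳ U₂ ≐ U →
          RegSum nothing (just (U₂ , A)) (just (U , A))
  both  : ∀ {U₁ U₂ U A} → U₁ ⊎ʳ U₂ ≐ U →
          RegSum (just (U₁ , A)) (just (U₂ , A)) (just (U , A))

infix 4 _⊎ⱽ_≐_ _⊎ᴿ_≐_

_⊎ⱽ_≐_ : (Γ₁ Γ₂ Γ : VarCtx k n) → Set
Γ₁ ⊎ⱽ Γ₂ ≐ Γ = ∀ x → VarSum (lookup Γ₁ x) (lookup Γ₂ x) (lookup Γ x)

_⊎ᴿ_≐_ : (R₁ R₂ R : RegCtx k) → Set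
R₁ ⊎ᴿ R₂ ≐ R = ∀ r → RegSum (lookup R₁ r) (lookup R₂ r) (lookup R r)

-- Contexts being unordered, R ⊢ says that some enumeration of the
-- hypotheses of R is stratified.
infix 4 _⊢ _⊢ᵀ_ _⊢ᴳ_ _⊢_≤_ _⊢_≤ᵉ_
mutual
  data _⊢ {k} : RegCtx k → Set where
    ∅   : replicate k nothing ⊢
    ext : ∀ {R r U A} → R ⊢ᵀ val A → lookup R r ≡ nothing →
          (R [ r ]≔ just (U , A)) ⊢

  data _⊢ᵀ_ {k} (R : RegCtx k) : Type k → Set where
    𝟏   : R ⊢ → R ⊢ᵀ val 𝟏
    𝐁   : R ⊢ → R ⊢ᵀ 𝐁
    !_  : ∀ {A} → R ⊢ᵀ val A → R ⊢ᵀ val (! A)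
    fun : ∀ {A e α} → R ⊢ᵀ val A → R ⊢ᵀ α → e ⊆ dom R →
          R ⊢ᵀ val (A ⊸[ e ] α)
    Reg : ∀ {r U A} → R ⊢ → R ∋ r ⦂ (U , A) → R ⊢ᵀ val (Reg r A)

_⊢ᴳ_ : RegCtx k → VarCtx k n → Set
R ⊢ᴳ Γ = ∀ {x u A} → Γ ∋ x ⦂ (u , A) → R ⊢ᵀ val A

data _⊢_≤_ {k} (R : RegCtx k) : Type k → Type k → Set where
  refl : ∀ {α} → R ⊢ α ≤ α
  !_   : ∀ {A A′} → R ⊢ val A ≤ val A′ → R ⊢ val (! A) ≤ val (! A′)
  fun  : ∀ {A A′ e e′ α α′} → e ⊆ e′ → e′ ⊆ dom R →
         R ⊢ val A′ ≤ val A → R ⊢ α ≤ α′ →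
         R ⊢ val (A ⊸[ e ] α) ≤ val (A′ ⊸[ e′ ] α′)

data _⊢_≤ᵉ_ {k} (R : RegCtx k) : Type k × Effect k → Type k × Effect k → Set where
  sub : ∀ {α α′ e e′} → e ⊆ e′ → e′ ⊆ dom R → R ⊢ α ≤ α′ →
        R ⊢ (α , e) ≤ᵉ (α′ , e′)

module TypeSystem {k : ℕ} (durability : Fin k → Durability) where

  affⱽ : VarHyp k → Set
  affⱽ (u , A) = u ≡ 𝟙

  affᴿ : Fin k → RegHyp k → Set
  affᴿ r (U , A) = (write U ≡ 𝟙 ⊎ read U ≡ 𝟙)
                 ⊎ (durability r ≡ volatile × read U ≢ 𝟎)

  aff : RegCtx k → VarCtx k n → Set
  aff R Γ = (∃ λ r → ∃ λ h → R ∋ r ⦂ h × affᴿ r h)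
          ⊎ (∃ λ x → ∃ λ h → Γ ∋ x ⦂ h × affⱽ h)

  saff : RegCtx k → VarCtx k n → Set
  saff R Γ = (∀ r h → R ∋ r ⦂ h → affᴿ r h)
           × (∀ x h → Γ ∋ x ⦂ h → affⱽ h)

  record WritePremises (d : Durability) (R : RegCtx k) (Γ : VarCtx k n)
                       (x : Fin n) (r : Fin k) (A : ValType k)
                       (R′ : RegCtx k) (Γ′ : VarCtx k n) : Set where
    field
      {u}         : VarUsage
      {U}         : RegUsage
      split-Γ     : singleton x (u , Reg r A) ⊎ⱽ Γ′ ≐ Γ
      kind        : durability r ≡ d
      split-R     : singleton r (U , A) ⊎ᴿ R′ ≐ R
      writable    : write U ≢ 𝟎
      well-formed : R ⊢ᴳ Γ

  infix 3 _⨾_⊢_⦂_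
  data _⨾_⊢_⦂_ {n} (R : RegCtx k) (Γ : VarCtx k n) :
               Exp n → Type k × Effect k → Set where

    var : ∀ {x u A} → R ⊢ᴳ Γ → Γ ∋ x ⦂ (u , A) →
          R ⨾ Γ ⊢ var x ⦂ (val A , ⊥)

    *   : R ⊢ᴳ Γ →
          R ⨾ Γ ⊢ * ⦂ (val 𝟏 , ⊥)

    ƛ   : ∀ {M A α e} →
          R ⨾ just (𝟙 , A) ∷ Γ ⊢ M ⦂ (α , e) →
          R ⨾ Γ ⊢ ƛ M ⦂ (val (A ⊸[ e ] α) , ⊥)

    app : ∀ {R₁ R₂ Γ₁ Γ₂ M N A α e e′ e″} →
          R₁ ⊎ᴿ R₂ ≐ R → Γ₁ ⊎ⱽ Γ₂ ≐ Γ →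
          R₁ ⨾ Γ₁ ⊢ M ⦂ (val (A ⊸[ e ] α) , e′) →
          R₂ ⨾ Γ₂ ⊢ N ⦂ (val A , e″) →
          R ⨾ Γ ⊢ M · N ⦂ (α , e ∪ e′ ∪ e″)

    bang : ∀ {R₁ R′ Γ₁ Γ′ M A e} →
          R₁ ⊎ᴿ R′ ≐ R → Γ₁ ⊎ⱽ Γ′ ≐ Γ →
          R ⊢ᴳ Γ → saff R′ Γ′ →
          R₁ ⨾ Γ₁ ⊢ M ⦂ (val A , e) → ¬ aff R₁ Γ₁ →
          R ⨾ Γ ⊢ ! M ⦂ (val (! A) , e)

    let! : ∀ {R₁ R₂ Γ₁ Γ₂ M N A α e e′} →
          R₁ ⊎ᴿ R₂ ≐ R → Γ₁ ⊎ⱽ Γ₂ ≐ Γ →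
          R₁ ⨾ Γ₁ ⊢ M ⦂ (val (! A) , e) →
          R₂ ⨾ just (∞ , A) ∷ Γ₂ ⊢ N ⦂ (α , e′) →
          R ⨾ Γ ⊢ let! M N ⦂ (α , e ∪ e′)

    ν   : ∀ {P u r A α e} →
          R ⨾ just (u , Reg r A) ∷ Γ ⊢ P ⦂ (α , e) →
          R ⨾ Γ ⊢ ν P ⦂ (α , e)

    get : ∀ {x u r A U} → R ⊢ᴳ Γ →
          Γ ∋ x ⦂ (u , Reg r A) → R ∋ r ⦂ (U , A) → read U ≢ 𝟎 →
          R ⨾ Γ ⊢ get (var x) ⦂ (val A , ⁅ r ⁆)

    set : ∀ {x r A V R′ Γ′} →
          WritePremises volatile R Γ x r A R′ Γ′ →
          R′ ⨾ Γ′ ⊢ V ⦂ (val A , ⊥) →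
          R ⨾ Γ ⊢ set (var x) V ⦂ (val 𝟏 , ⁅ r ⁆)

    store← : ∀ {x r A V R′ Γ′} →
          WritePremises volatile R Γ x r A R′ Γ′ →
          R′ ⨾ Γ′ ⊢ V ⦂ (val A , ⊥) →
          R ⨾ Γ ⊢ var x ← V ⦂ (𝐁 , ⊥)

    pset : ∀ {x r A V R′ Γ′} →
          WritePremises persistent R Γ x r (! A) R′ Γ′ →
          R′ ⨾ Γ′ ⊢ V ⦂ (val (! A) , ⊥) →
          R ⨾ Γ ⊢ pset (var x) V ⦂ (val 𝟏 , ⁅ r ⁆)

    store⇐ : ∀ {x r A V R′ Γ′} →
          WritePremises persistent R Γ x r (! A) R′ Γ′ →
          R′ ⨾ Γ′ ⊢ V ⦂ (val (! A) , ⊥) →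
          R ⨾ Γ ⊢ var x ⇐ V ⦂ (𝐁 , ⊥)

    par-store : ∀ {R₁ R₂ Γ₁ Γ₂ P S α e} →
          R₁ ⊎ᴿ R₂ ≐ R → Γ₁ ⊎ⱽ Γ₂ ≐ Γ →
          R₁ ⨾ Γ₁ ⊢ P ⦂ (α , e) →
          R₂ ⨾ Γ₂ ⊢ S ⦂ (𝐁 , ⊥) → Store S →
          R ⨾ Γ ⊢ P ∥ S ⦂ (α , e)

    store-par : ∀ {R₁ R₂ Γ₁ Γ₂ P S α e} →
          R₁ ⊎ᴿ R₂ ≐ R → Γ₁ ⊎ⱽ Γ₂ ≐ Γ →
          R₁ ⨾ Γ₁ ⊢ S ⦂ (𝐁 , ⊥) → Store S →
          R₂ ⨾ Γ₂ ⊢ P ⦂ (α , e) →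
          R ⨾ Γ ⊢ S ∥ P ⦂ (α , e)

    par : ∀ {R₁ R₂ Γ₁ Γ₂ P₁ P₂ α₁ α₂ e₁ e₂} →
          R₁ ⊎ᴿ R₂ ≐ R → Γ₁ ⊎ⱽ Γ₂ ≐ Γ →
          R₁ ⨾ Γ₁ ⊢ P₁ ⦂ (α₁ , e₁) → ¬ Store P₁ →
          R₂ ⨾ Γ₂ ⊢ P₂ ⦂ (α₂ , e₂) → ¬ Store P₂ →
          R ⨾ Γ ⊢ P₁ ∥ P₂ ⦂ (𝐁 , e₁ ∪ e₂)

    subsume : ∀ {M α α′ e e′} → Term M →
          R ⨾ Γ ⊢ M ⦂ (α , e) → R ⊢ (α , e) ≤ᵉ (α′ , e′) →
          R ⨾ Γ ⊢ M ⦂ (α′ , e′)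

{-# OPTIONS --safe #-}

-- Usages play no role.  Replacing each variable of type Reg r A by a region
-- constant r and deleting every ν turns structural equivalence into the
-- associativity and commutativity of ∥.  In the resulting calculus a read
-- from r may return any value of the interpretation of the type of r, whatever
-- the stores contain, so the threads no longer interact and each can be
-- treated by a reducibility argument.  Such an interpretation exists because
-- in a stratified region context the type of r only mentions effects on
-- regions introduced before r; and since the writes of reducible threads stay
-- within it, the actual reductions are among those considered.

module Submission where

open import Defs
open import Data.Empty using (⊥; ⊥-elim)
open import Data.Fin.Base using (Fin; zero; suc)
open import Data.Fin.Properties using (_≟_)
open import Data.Fin.Subset using (_∈_; _⊆_; ⁅_⁆; _∪_)
open import Data.Fin.Subset.Properties using (x∈⁅x⁆; p⊆p∪q; q⊆p∪q; ⊥⊆)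
open import Data.Maybe.Base using (Maybe; just; nothing; is-just)
open import Data.Nat.Base using (ℕ; suc)
open import Data.Product.Base using (_×_; _,_; ∃; ∃₂; proj₁; proj₂; Σ)
open import Data.Sum.Base using (_⊎_; inj₁; inj₂)
open import Data.Unit.Base using (⊤; tt)
open import Data.Vec.Base using (_∷_; lookup; replicate; _[_]≔_)
open import Data.Vec.Properties
  using ([]=⇒lookup; lookup-map; lookup-replicate; lookup∘update; lookup∘update′)
open import Function.Base using (_∘_; id; case_of_)
open import Induction.WellFounded using (Acc; acc)
open import Relation.Binary.PropositionalEquality as ≡ using (_≡_; refl; cong; cong₂)
open import Relation.Nullary.Decidable.Core using (yes; no)

private
  variable
    k m n p : ℕ

-- The target calculus and its substitution lemmas.

infix  9 !_
infixl 8 _·_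
infixr 5 _∥_ _∙_

-- Volatile and persistent writes share `set`, and stores have no counterpart: what a read returns
-- is left to the transition system.
data Tm (k n : ℕ) : Set where
  var  : Fin n → Tm k n
  reg  : Fin k → Tm k n
  *    : Tm k n
  ƛ    : Tm k (suc n) → Tm k n
  !_   : Tm k n → Tm k n
  _·_  : Tm k n → Tm k n → Tm k n
  let! : Tm k n → Tm k (suc n) → Tm k n
  set  : Tm k n → Tm k n → Tm k n
  get  : Tm k n → Tm k n
  _∥_  : Tm k n → Tm k n → Tm k n

ren : (Fin m → Fin n) → Tm k m → Tm k n
ren ρ (var x)    = var (ρ x)
ren ρ (reg r)    = reg r
ren ρ *          = *
ren ρ (ƛ T)      = ƛ (ren (extᵣ ρ) T)
ren ρ (! T)      = ! ren ρ T
ren ρ (S · T)    = ren ρ S · ren ρ T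
ren ρ (let! S T) = let! (ren ρ S) (ren (extᵣ ρ) T)
ren ρ (set S T)  = set (ren ρ S) (ren ρ T)
ren ρ (get T)    = get (ren ρ T)
ren ρ (S ∥ T)    = ren ρ S ∥ ren ρ T

lift : (Fin m → Tm k n) → Fin (suc m) → Tm k (suc n)
lift σ zero    = var zero
lift σ (suc x) = ren suc (σ x)

subs : (Fin m → Tm k n) → Tm k m → Tm k n
subs σ (var x)    = σ x
subs σ (reg r)    = reg r
subs σ *          = *
subs σ (ƛ T)      = ƛ (subs (lift σ) T)
subs σ (! T)      = ! subs σ T
subs σ (S · T)    = subs σ S · subs σ T
subs σ (let! S T) = let! (subs σ S) (subs (lift σ) T)
subs σ (set S T)  = set (subs σ S) (subs σ T)
subs σ (get T)    = get (subs σ T)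
subs σ (S ∥ T)    = subs σ S ∥ subs σ T

_∙_ : ∀ {A : Set} → A → (Fin n → A) → Fin (suc n) → A
(a ∙ σ) zero    = a
(a ∙ σ) (suc x) = σ x

infix 10 _⟨_⟩
_⟨_⟩ : Tm k (suc n) → Tm k n → Tm k n
T ⟨ V ⟩ = subs (V ∙ var) T

-- Naming the composite `τ` and assuming a pointwise equation takes the place of function
-- extensionality: at a binder only that assumption is extended. The later composition lemmas follow
-- the same pattern.
sub-ren : {σ : Fin n → Tm k p} {ρ : Fin m → Fin n} {τ : Fin m → Tm k p} →
          (∀ x → σ (ρ x) ≡ τ x) → ∀ T → subs σ (ren ρ T) ≡ subs τ T
sub-ren h (var x)    = h x
sub-ren h (reg r)    = refl
sub-ren h *          = refl
sub-ren h (ƛ T)      = cong ƛ (sub-ren (λ { zero → refl ; (suc x) → cong (ren suc) (h x) }) T)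
sub-ren h (! T)      = cong !_ (sub-ren h T)
sub-ren h (S · T)    = cong₂ _·_ (sub-ren h S) (sub-ren h T)
sub-ren h (let! S T) = cong₂ let! (sub-ren h S)
                         (sub-ren (λ { zero → refl ; (suc x) → cong (ren suc) (h x) }) T)
sub-ren h (set S T)  = cong₂ set (sub-ren h S) (sub-ren h T)
sub-ren h (get T)    = cong get (sub-ren h T)
sub-ren h (S ∥ T)    = cong₂ _∥_ (sub-ren h S) (sub-ren h T)

sub-var : {σ : Fin m → Tm k n} {ρ : Fin m → Fin n} →
          (∀ x → σ x ≡ var (ρ x)) → ∀ T → subs σ T ≡ ren ρ T
sub-var h (var x)    = h x
sub-var h (reg r)    = refl
sub-var h *          = refl
sub-var h (ƛ T)      = cong ƛ (sub-var (λ { zero → refl ; (suc x) → cong (ren suc) (h x) }) T)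
sub-var h (! T)      = cong !_ (sub-var h T)
sub-var h (S · T)    = cong₂ _·_ (sub-var h S) (sub-var h T)
sub-var h (let! S T) = cong₂ let! (sub-var h S)
                         (sub-var (λ { zero → refl ; (suc x) → cong (ren suc) (h x) }) T)
sub-var h (set S T)  = cong₂ set (sub-var h S) (sub-var h T)
sub-var h (get T)    = cong get (sub-var h T)
sub-var h (S ∥ T)    = cong₂ _∥_ (sub-var h S) (sub-var h T)

sub-id : {σ : Fin n → Tm k n} → (∀ x → σ x ≡ var x) → ∀ T → subs σ T ≡ T
sub-id h (var x)    = h x
sub-id h (reg r)    = refl
sub-id h *          = refl
sub-id h (ƛ T)      = cong ƛ (sub-id (λ { zero → refl ; (suc x) → cong (ren suc) (h x) }) T)
sub-id h (! T)      = cong !_ (sub-id h T)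
sub-id h (S · T)    = cong₂ _·_ (sub-id h S) (sub-id h T)
sub-id h (let! S T) = cong₂ let! (sub-id h S)
                        (sub-id (λ { zero → refl ; (suc x) → cong (ren suc) (h x) }) T)
sub-id h (set S T)  = cong₂ set (sub-id h S) (sub-id h T)
sub-id h (get T)    = cong get (sub-id h T)
sub-id h (S ∥ T)    = cong₂ _∥_ (sub-id h S) (sub-id h T)

-- A renaming is a substitution by variables, which reduces this to `sub-ren`.
ren-ren : (ρ : Fin n → Fin p) (ρ′ : Fin m → Fin n) (T : Tm k m) →
          ren ρ (ren ρ′ T) ≡ ren (ρ ∘ ρ′) T
ren-ren ρ ρ′ T = begin
  ren ρ (ren ρ′ T)          ≡⟨ sub-var (λ _ → refl) (ren ρ′ T) ⟨
  subs (var ∘ ρ) (ren ρ′ T)  ≡⟨ sub-ren (λ _ → refl) T ⟩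
  subs (var ∘ ρ ∘ ρ′) T      ≡⟨ sub-var (λ _ → refl) T ⟩
  ren (ρ ∘ ρ′) T            ∎
  where open ≡.≡-Reasoning

ren-sub : {ρ : Fin n → Fin p} {σ : Fin m → Tm k n} {τ : Fin m → Tm k p} →
          (∀ x → ren ρ (σ x) ≡ τ x) → ∀ T → ren ρ (subs σ T) ≡ subs τ T

ren-lift : {ρ : Fin n → Fin p} {σ : Fin m → Tm k n} {τ : Fin m → Tm k p} →
           (∀ x → ren ρ (σ x) ≡ τ x) → ∀ x → ren (extᵣ ρ) (lift σ x) ≡ lift τ x
ren-lift h zero = refl
ren-lift {ρ = ρ} {σ} h (suc x) =
  ≡.trans (ren-ren (extᵣ ρ) suc (σ x))
    (≡.trans (≡.sym (ren-ren suc ρ (σ x))) (cong (ren suc) (h x)))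

ren-sub h (var x)    = h x
ren-sub h (reg r)    = refl
ren-sub h *          = refl
ren-sub h (ƛ T)      = cong ƛ (ren-sub (ren-lift h) T)
ren-sub h (! T)      = cong !_ (ren-sub h T)
ren-sub h (S · T)    = cong₂ _·_ (ren-sub h S) (ren-sub h T)
ren-sub h (let! S T) = cong₂ let! (ren-sub h S) (ren-sub (ren-lift h) T)
ren-sub h (set S T)  = cong₂ set (ren-sub h S) (ren-sub h T)
ren-sub h (get T)    = cong get (ren-sub h T)
ren-sub h (S ∥ T)    = cong₂ _∥_ (ren-sub h S) (ren-sub h T)

sub-lift : {θ : Fin n → Tm k p} {σ : Fin m → Tm k n} {τ : Fin m → Tm k p} →
           (∀ x → subs θ (σ x) ≡ τ x) → ∀ x → subs (lift θ) (lift σ x) ≡ lift τ x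
sub-lift h zero = refl
sub-lift {σ = σ} h (suc x) =
  ≡.trans (sub-ren (λ _ → refl) (σ x))
        (≡.trans (≡.sym (ren-sub (λ _ → refl) (σ x))) (cong (ren suc) (h x)))

sub-sub : {θ : Fin n → Tm k p} {σ : Fin m → Tm k n} {τ : Fin m → Tm k p} →
          (∀ x → subs θ (σ x) ≡ τ x) → ∀ T → subs θ (subs σ T) ≡ subs τ T
sub-sub h (var x)    = h x
sub-sub h (reg r)    = refl
sub-sub h *          = refl
sub-sub h (ƛ T)      = cong ƛ (sub-sub (sub-lift h) T)
sub-sub h (! T)      = cong !_ (sub-sub h T)
sub-sub h (S · T)    = cong₂ _·_ (sub-sub h S) (sub-sub h T)
sub-sub h (let! S T) = cong₂ let! (sub-sub h S) (sub-sub (sub-lift h) T)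
sub-sub h (set S T)  = cong₂ set (sub-sub h S) (sub-sub h T)
sub-sub h (get T)    = cong get (sub-sub h T)
sub-sub h (S ∥ T)    = cong₂ _∥_ (sub-sub h S) (sub-sub h T)

weaken-⟨⟩ : (V T : Tm k n) → ren suc T ⟨ V ⟩ ≡ T
weaken-⟨⟩ V T = ≡.trans (sub-ren (λ _ → refl) T) (sub-id (λ _ → refl) T)

-- Turns the contractum of a β or `let!` step into the body under an extended environment, the form
-- that the induction hypothesis for the body provides.
lift-⟨⟩ : (σ : Fin m → Tm k n) (V : Tm k n) (T : Tm k (suc m)) →
          subs (lift σ) T ⟨ V ⟩ ≡ subs (V ∙ σ) T
lift-⟨⟩ σ V = sub-sub λ { zero → refl ; (suc x) → weaken-⟨⟩ V (σ x) }

-- Erasure of programs.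

-- Erases G σ P T: T is P with σ applied, every ν deleted after its bound
-- variable has been replaced by some region constant, and every store
-- replaced by *.  A store with address S and content V is accepted only if
-- G S V; below binders, where NoStore stands for G, there are no stores.

NoStore : Tm k m → Tm k m → Set
NoStore _ _ = ⊥

data Erases {k m n} (G : Tm k m → Tm k m → Set) (σ : Fin n → Tm k m) :
            Exp n → Tm k m → Set where
  var  : ∀ {x T} → σ x ≡ T → Erases G σ (var x) T
  *    : Erases G σ * *
  ƛ    : ∀ {M T} → Erases NoStore (lift σ) M T → Erases G σ (ƛ M) (ƛ T)
  !_   : ∀ {M T} → Erases G σ M T → Erases G σ (! M) (! T)
  _·_  : ∀ {M N S T} → Erases G σ M S → Erases G σ N T → Erases G σ (M · N) (S · T)
  let! : ∀ {M N S T} → Erases G σ M S → Erases NoStore (lift σ) N T →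
         Erases G σ (let! M N) (let! S T)
  ν    : ∀ {M T} r → Erases G (reg r ∙ σ) M T → Erases G σ (ν M) T
  set  : ∀ {M N S T} → Erases G σ M S → Erases G σ N T → Erases G σ (set M N) (set S T)
  pset : ∀ {M N S T} → Erases G σ M S → Erases G σ N T → Erases G σ (pset M N) (set S T)
  get  : ∀ {M T} → Erases G σ M T → Erases G σ (get M) (get T)
  _∥_  : ∀ {M N S T} → Erases G σ M S → Erases G σ N T → Erases G σ (M ∥ N) (S ∥ T)
  st←  : ∀ {M N S T} → Erases G σ M S → Erases G σ N T → G S T → Erases G σ (M ← N) *
  st⇐  : ∀ {M N S T} → Erases G σ M S → Erases G σ N T → G S T → Erases G σ (M ⇐ N) *

private
  variable
    G G′ : Tm k m → Tm k m → Set

-- With `NoStore` on the left no store case arises, in which `G` would have to be carried along `θ`.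
-- At a ν the substitution `θ` is not lifted, since it fixes region constants.
erase-sub : {σ : Fin n → Tm k m} {θ : Fin m → Tm k p} {τ : Fin n → Tm k p} →
            (∀ x → subs θ (σ x) ≡ τ x) →
            ∀ {M T} → Erases NoStore σ M T → Erases G τ M (subs θ T)
erase-sub {θ = θ} h (var {x} eq) = var (≡.trans (≡.sym (h x)) (cong (subs θ) eq))
erase-sub h *          = *
erase-sub h (ƛ M)      = ƛ (erase-sub (sub-lift h) M)
erase-sub h (! M)      = ! erase-sub h M
erase-sub h (M · N)    = erase-sub h M · erase-sub h N
erase-sub h (let! M N) = let! (erase-sub h M) (erase-sub (sub-lift h) N)
erase-sub h (ν r M)    = ν r (erase-sub (λ { zero → refl ; (suc x) → h x }) M)
erase-sub h (set M N)  = set (erase-sub h M) (erase-sub h N)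
erase-sub h (pset M N) = pset (erase-sub h M) (erase-sub h N)
erase-sub h (get M)    = get (erase-sub h M)
erase-sub h (M ∥ N)    = erase-sub h M ∥ erase-sub h N

erase-cong : {σ τ : Fin n → Tm k m} → (∀ x → σ x ≡ τ x) →
             ∀ {M T} → Erases NoStore σ M T → Erases G τ M T
erase-cong {σ = σ} h {T = T} M =
  ≡.subst (Erases _ _ _) (sub-id (λ _ → refl) T)
    (erase-sub (λ x → ≡.trans (sub-id (λ _ → refl) (σ x)) (h x)) M)

erase-ren : {σ : Fin n → Tm k m} (ρ : Fin m → Fin p) →
            ∀ {M T} → Erases NoStore σ M T → Erases G (ren ρ ∘ σ) M (ren ρ T)
erase-ren {σ = σ} ρ {T = T} M =
  ≡.subst (Erases _ _ _) (sub-var (λ _ → refl) T)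
    (erase-sub (λ x → sub-var (λ _ → refl) (σ x)) M)

lift-extᵣ : {σ : Fin n → Tm k p} {ρ : Fin m → Fin n} {τ : Fin m → Tm k p} →
            (∀ x → σ (ρ x) ≡ τ x) → ∀ x → lift σ (extᵣ ρ x) ≡ lift τ x
lift-extᵣ h zero    = refl
lift-extᵣ h (suc x) = cong (ren suc) (h x)

∙-extᵣ : {σ : Fin n → Tm k p} {ρ : Fin m → Fin n} {τ : Fin m → Tm k p} {V : Tm k p} →
         (∀ x → σ (ρ x) ≡ τ x) → ∀ x → (V ∙ σ) (extᵣ ρ x) ≡ (V ∙ τ) x
∙-extᵣ h zero    = refl
∙-extᵣ h (suc x) = h x

erase-rename : {σ : Fin n → Tm k p} {ρ : Fin m → Fin n} {τ : Fin m → Tm k p} →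
               (∀ x → σ (ρ x) ≡ τ x) →
               ∀ {M T} → Erases G τ M T → Erases G σ (rename ρ M) T
erase-rename h (var {x} eq) = var (≡.trans (h x) eq)
erase-rename h *           = *
erase-rename h (ƛ M)       = ƛ (erase-rename (lift-extᵣ h) M)
erase-rename h (! M)       = ! erase-rename h M
erase-rename h (M · N)     = erase-rename h M · erase-rename h N
erase-rename h (let! M N)  = let! (erase-rename h M) (erase-rename (lift-extᵣ h) N)
erase-rename h (ν r M)     = ν r (erase-rename (∙-extᵣ h) M)
erase-rename h (set M N)   = set (erase-rename h M) (erase-rename h N)
erase-rename h (pset M N)  = pset (erase-rename h M) (erase-rename h N)
erase-rename h (get M)     = get (erase-rename h M)
erase-rename h (M ∥ N)     = erase-rename h M ∥ erase-rename h N
erase-rename h (st← M N g) = st← (erase-rename h M) (erase-rename h N) g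
erase-rename h (st⇐ M N g) = st⇐ (erase-rename h M) (erase-rename h N) g

-- Strengthening, for the direction of structural equivalence that narrows the scope of a ν. The
-- recursion is on `M` because it has to expose the shape of `rename ρ M`.
erase-unrename : {σ : Fin n → Tm k p} {ρ : Fin m → Fin n} {τ : Fin m → Tm k p} →
                 (∀ x → σ (ρ x) ≡ τ x) →
                 ∀ M {T} → Erases G σ (rename ρ M) T → Erases G τ M T
erase-unrename h (var x)    (var eq)    = var (≡.trans (≡.sym (h x)) eq)
erase-unrename h *          *           = *
erase-unrename h (ƛ M)      (ƛ a)       = ƛ (erase-unrename (lift-extᵣ h) M a)
erase-unrename h (! M)      (! a)       = ! erase-unrename h M a
erase-unrename h (M · N)    (a · b)     = erase-unrename h M a · erase-unrename h N b
erase-unrename h (let! M N) (let! a b)  =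
  let! (erase-unrename h M a) (erase-unrename (lift-extᵣ h) N b)
erase-unrename h (ν M)      (ν r a)     = ν r (erase-unrename (∙-extᵣ h) M a)
erase-unrename h (set M N)  (set a b)   = set (erase-unrename h M a) (erase-unrename h N b)
erase-unrename h (pset M N) (pset a b)  = pset (erase-unrename h M a) (erase-unrename h N b)
erase-unrename h (get M)    (get a)     = get (erase-unrename h M a)
erase-unrename h (M ∥ N)    (a ∥ b)     = erase-unrename h M a ∥ erase-unrename h N b
erase-unrename h (M ← N)    (st← a b g) = st← (erase-unrename h M a) (erase-unrename h N b) g
erase-unrename h (M ⇐ N)    (st⇐ a b g) = st⇐ (erase-unrename h M a) (erase-unrename h N b) g

-- All `G` are covered because a substituted expression may land below a binder, where `NoStore` is
-- in force, as well as outside one.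
ErasesSubst : (Fin m → Exp n) → (Fin n → Tm k p) → (Fin m → Tm k p) → Set₁
ErasesSubst τ σ σ′ = ∀ x {G} → Erases G σ (τ x) (σ′ x)

erase-extₛ : {τ : Fin m → Exp n} {σ : Fin n → Tm k p} {σ′ : Fin m → Tm k p} →
             ErasesSubst τ σ σ′ → ErasesSubst (extₛ τ) (lift σ) (lift σ′)
erase-extₛ h zero    = var refl
erase-extₛ h (suc x) = erase-rename (λ _ → refl) (erase-ren suc (h x))

erase-extₛ-∙ : {τ : Fin m → Exp n} {σ : Fin n → Tm k p} {σ′ : Fin m → Tm k p} {V : Tm k p} →
               ErasesSubst τ σ σ′ → ErasesSubst (extₛ τ) (V ∙ σ) (V ∙ σ′)
erase-extₛ-∙ h zero    = var refl
erase-extₛ-∙ h (suc x) = erase-rename (λ _ → refl) (h x)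

erase-subst : {τ : Fin m → Exp n} {σ : Fin n → Tm k p} {σ′ : Fin m → Tm k p} →
              ErasesSubst τ σ σ′ →
              ∀ {M T} → Erases G σ′ M T → Erases G σ (subst τ M) T
erase-subst h (var {x} refl) = h x
erase-subst h *           = *
erase-subst h (ƛ M)       = ƛ (erase-subst (erase-extₛ h) M)
erase-subst h (! M)       = ! erase-subst h M
erase-subst h (M · N)     = erase-subst h M · erase-subst h N
erase-subst h (let! M N)  = let! (erase-subst h M) (erase-subst (erase-extₛ h) N)
erase-subst h (ν r M)     = ν r (erase-subst (erase-extₛ-∙ h) M)
erase-subst h (set M N)   = set (erase-subst h M) (erase-subst h N)
erase-subst h (pset M N)  = pset (erase-subst h M) (erase-subst h N)
erase-subst h (get M)     = get (erase-subst h M)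
erase-subst h (M ∥ N)     = erase-subst h M ∥ erase-subst h N
erase-subst h (st← M N g) = st← (erase-subst h M) (erase-subst h N) g
erase-subst h (st⇐ M N g) = st⇐ (erase-subst h M) (erase-subst h N) g

-- Outside its abstractions a value has no stores, and inside them `NoStore` is already in force; so
-- any predicate can replace `G`.
erase-value : {σ : Fin n → Tm k m} → ∀ {V T} → Value V → Erases G σ V T → Erases G′ σ V T
erase-value (var x) (var eq) = var eq
erase-value *       *        = *
erase-value (ƛ _)   (ƛ M)    = ƛ M
erase-value (! V)   (! M)    = ! erase-value V M

-- Substituting `T` in the erasure first turns the lifted environment into `T ∙ σ`; then `V` can
-- replace the source variable that stands for `T`.
erase-[] : {σ : Fin n → Tm k m} → ∀ {M V S T} →
           Erases NoStore (lift σ) M S → Value V → Erases G σ V T →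
           Erases G σ (M [ V ]) (S ⟨ T ⟩)
erase-[] {σ = σ} {T = T} body v arg =
  erase-subst {σ′ = T ∙ σ} (λ { zero → erase-value v arg ; (suc x) → var refl })
    (erase-sub (λ { zero → refl ; (suc x) → weaken-⟨⟩ T (σ x) }) body)

-- Values and labelled transitions.

data Val {k n} : Tm k n → Set where
  reg : ∀ r → Val (reg r)
  *   : Val *
  ƛ   : ∀ T → Val (ƛ T)
  !_  : ∀ {V} → Val V → Val (! V)

erased-value : {σ : Fin n → Tm k m} → (∀ x → Val (σ x)) →
               ∀ {V T} → Value V → Erases G σ V T → Val T
erased-value h (var x) (var refl) = h x
erased-value h *       *          = *
erased-value h (ƛ _)   (ƛ _)      = ƛ _
erased-value h (! V)   (! M)      = ! erased-value h V M

-- A read returns an arbitrary term here, and addresses need not be regions;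
-- Offered and Permitted below impose these restrictions.

data Label (k : ℕ) : Set where
  τ     : Label k
  wr rd : (S V : Tm k 0) → Label k

infix 4 _—[_]→_
data _—[_]→_ {k} : Tm k 0 → Label k → Tm k 0 → Set where
  β     : ∀ {T V} → Val V → ƛ T · V —[ τ ]→ T ⟨ V ⟩
  let!  : ∀ {T V} → Val V → let! (! V) T —[ τ ]→ T ⟨ V ⟩
  set   : ∀ {S V} → set S V —[ wr S V ]→ *
  get   : ∀ {S V} → get S —[ rd S V ]→ V
  appˡ  : ∀ {l S S′ T} → S —[ l ]→ S′ → S · T —[ l ]→ S′ · T
  appʳ  : ∀ {l V T T′} → Val V → T —[ l ]→ T′ → V · T —[ l ]→ V · T′
  !_    : ∀ {l T T′} → T —[ l ]→ T′ → ! T —[ l ]→ ! T′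
  let!ˡ : ∀ {l S S′ T} → S —[ l ]→ S′ → let! S T —[ l ]→ let! S′ T
  parˡ  : ∀ {l S S′ T} → S —[ l ]→ S′ → S ∥ T —[ l ]→ S′ ∥ T
  parʳ  : ∀ {l S T T′} → T —[ l ]→ T′ → S ∥ T —[ l ]→ S ∥ T′

val-stuck : ∀ {l} {V T : Tm k 0} → Val V → V —[ l ]→ T → ⊥
val-stuck (! v) (! s) = val-stuck v s

-- Structural equivalence on erasures.

-- Besides comm and assoc, components may be dropped and inert ones added; in
-- one direction only, which is all that transferring termination needs.
infix 4 _⊒_
data _⊒_ {k} : Tm k 0 → Tm k 0 → Set where
  refl   : ∀ {T} → T ⊒ T
  trans  : ∀ {S T U} → S ⊒ T → T ⊒ U → S ⊒ U
  cong-∥ : ∀ {S S′ T T′} → S ⊒ S′ → T ⊒ T′ → S ∥ T ⊒ S′ ∥ T′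
  comm   : ∀ {S T} → S ∥ T ⊒ T ∥ S
  assoc  : ∀ {S T U} → (S ∥ T) ∥ U ⊒ S ∥ (T ∥ U)
  drop   : ∀ {S T} → S ∥ T ⊒ S
  pad    : ∀ {T} → T ⊒ T ∥ *

-- Two cyclic rotations by `comm` and `assoc`, then a swap, reverse the bracketing.
assoc⁻¹ : {S T U : Tm k 0} → S ∥ (T ∥ U) ⊒ (S ∥ T) ∥ U
assoc⁻¹ = trans comm (trans assoc (trans comm (trans assoc comm)))

-- A component dropped on the right stays idle on the left, and the `*` added by `pad` has no step,
-- so every step on the right is available on the left.
⊒-simulates : ∀ {l} {T T′ U′ : Tm k 0} → T ⊒ T′ → T′ —[ l ]→ U′ →
              ∃ λ U → T —[ l ]→ U × U ⊒ U′
⊒-simulates refl s = _ , s , refl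
⊒-simulates (trans h h′) s with ⊒-simulates h′ s
... | _ , s′ , g′ with ⊒-simulates h s′
...   | _ , s″ , g = _ , s″ , trans g g′
⊒-simulates (cong-∥ h h′) (parˡ s) with ⊒-simulates h s
... | _ , s′ , g = _ , parˡ s′ , cong-∥ g h′
⊒-simulates (cong-∥ h h′) (parʳ s) with ⊒-simulates h′ s
... | _ , s′ , g = _ , parʳ s′ , cong-∥ h g
⊒-simulates comm  (parˡ s)        = _ , parʳ s , comm
⊒-simulates comm  (parʳ s)        = _ , parˡ s , comm
⊒-simulates assoc (parˡ s)        = _ , parˡ (parˡ s) , assoc
⊒-simulates assoc (parʳ (parˡ s)) = _ , parˡ (parʳ s) , assoc
⊒-simulates assoc (parʳ (parʳ s)) = _ , parʳ s , assoc
⊒-simulates drop  s               = _ , parˡ s , drop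
⊒-simulates pad   (parˡ s)        = _ , s , pad

-- All environments are covered because passing under a ν extends the environment by a region.
Transfers : (Tm k 0 → Tm k 0 → Set) → Exp n → Exp n → Set
Transfers {k} {n} G P Q = ∀ {σ : Fin n → Tm k 0} {T} → Erases G σ P T →
                          ∃ λ T′ → Erases G σ Q T′ × T ⊒ T′

transfer-static : ∀ {m n} {P Q : Exp m} (C : SCtx m n) →
                  Transfers {k} G P Q → Transfers G (C ⟪ P ⟫) (C ⟪ Q ⟫)
transfer-static □ f a = f a
transfer-static (parˡ C _) f (a ∥ b) with transfer-static C f a
... | _ , a′ , h = _ , a′ ∥ b , cong-∥ h refl
transfer-static (parʳ _ C) f (a ∥ b) with transfer-static C f b
... | _ , b′ , h = _ , a ∥ b′ , cong-∥ refl h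
transfer-static (ν C) f (ν r a) with transfer-static C f a
... | _ , a′ , h = _ , ν r a′ , h

-- The region chosen for the ν moves into the environment, where the weakened context does not see
-- it; the erasure `T` is unchanged.
extrude : {σ : Fin n → Tm k m} (E : ECtx n) → ∀ {M T} →
          Erases G σ (E ⟦ ν M ⟧) T → ∃ λ r → Erases G (reg r ∙ σ) (renameᴱ suc E ⟦ M ⟧) T
extrude □ (ν r a) = r , a
extrude (appˡ E _) (a · b) with extrude E a
... | r , a′ = r , a′ · erase-rename (λ _ → refl) b
extrude (appʳ _ E) (a · b) with extrude E b
... | r , b′ = r , erase-rename (λ _ → refl) a · b′
extrude (! E) (! a) with extrude E a
... | r , a′ = r , ! a′
extrude (let! E _) (let! a b) with extrude E a
... | r , a′ = r , let! a′ (erase-rename (lift-extᵣ (λ _ → refl)) b)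

intrude : {σ : Fin n → Tm k m} (E : ECtx n) → ∀ {M T} r →
          Erases G (reg r ∙ σ) (renameᴱ suc E ⟦ M ⟧) T → Erases G σ (E ⟦ ν M ⟧) T
intrude □ r a = ν r a
intrude (appˡ E _) r (a · b)    = intrude E r a · erase-unrename (λ _ → refl) _ b
intrude (appʳ _ E) r (a · b)    = erase-unrename (λ _ → refl) _ a · intrude E r b
intrude (! E)      r (! a)      = ! intrude E r a
intrude (let! E _) r (let! a b) =
  let! (intrude E r a) (erase-unrename (lift-extᵣ (λ _ → refl)) _ b)

-- Both directions are proved at once because of `sym`; the relation `⊒` is not symmetric.
≋-transfers : {P Q : Exp n} → P ≋ Q → Transfers {k} G P Q × Transfers G Q P
≋-transfers refl = (λ a → _ , a , refl) , (λ a → _ , a , refl)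
≋-transfers (sym h) = let f , g = ≋-transfers h in g , f
≋-transfers (trans h h′) =
  let f , g = ≋-transfers h ; f′ , g′ = ≋-transfers h′ in
  (λ a → let _ , b , p = f a  ; _ , c , q = f′ b in _ , c , trans p q) ,
  (λ a → let _ , b , p = g′ a ; _ , c , q = g b  in _ , c , trans p q)
≋-transfers (static C h) =
  let f , g = ≋-transfers h in transfer-static C f , transfer-static C g
≋-transfers (comm P Q) = (λ { (a ∥ b) → _ , b ∥ a , comm }) , (λ { (a ∥ b) → _ , b ∥ a , comm })
≋-transfers (assoc P Q T) =
  (λ { ((a ∥ b) ∥ c) → _ , a ∥ (b ∥ c) , assoc }) ,
  (λ { (a ∥ (b ∥ c)) → _ , (a ∥ b) ∥ c , assoc⁻¹ })
≋-transfers (ν-par P Q) =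
  (λ { (ν r a ∥ b) → _ , ν r (a ∥ erase-rename (λ _ → refl) b) , refl }) ,
  (λ { (ν r (a ∥ b)) → _ , ν r a ∥ erase-unrename (λ _ → refl) Q b , refl })
≋-transfers (ν-eval E M) =
  (λ a → let r , a′ = extrude E a in _ , ν r a′ , refl) ,
  (λ { (ν r a) → _ , intrude E r a , refl })

-- Computability relative to an oracle.

Oracle : ℕ → Set₁
Oracle k = Fin k → Tm k 0 → Set

Stored : Oracle k → Tm k 0 → Tm k 0 → Set
Stored O S V = ∃ λ r → S ≡ reg r × O r V

Permitted : Oracle k → Effect k → Label k → Set
Permitted O e τ        = ⊤
Permitted O e (wr S V) = ∃ λ r → S ≡ reg r × r ∈ e × O r V
Permitted O e (rd S V) = ∃ λ r → S ≡ reg r × r ∈ e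

Offered : Oracle k → Label k → Set
Offered O τ        = ⊤
Offered O (wr S V) = ⊤
Offered O (rd S V) = Val V × Stored O S V

-- Accessibility along the transitions that the oracle offers, so termination is built in.
-- `Permitted` is the guarantee of the term, owed even for reads that are not offered; `Offered` is
-- its assumption about the surroundings.
data 𝓒 {k} (O : Oracle k) (e : Effect k) (Q : Tm k 0 → Set) (T : Tm k 0) : Set where
  comp : (Val T → Q T) →
         (∀ {l T′} → T —[ l ]→ T′ → Permitted O e l × (Offered O l → 𝓒 O e Q T′)) →
         𝓒 O e Q T

private
  variable
    O O′ : Oracle k
    e e′ e₁ e₂ : Effect k
    Q Q′ Q₁ Q₂ : Tm k 0 → Set

𝓒-step : ∀ {l} {T T′ : Tm k 0} → 𝓒 O e Q T → T —[ l ]→ T′ →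
         Permitted O e l × (Offered O l → 𝓒 O e Q T′)
𝓒-step (comp _ next) = next

𝓒-result : {T : Tm k 0} → 𝓒 O e Q T → Val T → Q T
𝓒-result (comp result _) = result

𝓒-val : ∀ {V} → Val V → Q V → 𝓒 {k} O e Q V
𝓒-val v q = comp (λ _ → q) (λ s → ⊥-elim (val-stuck v s))

permitted-map : e ⊆ e′ → (∀ {r V} → r ∈ e → O r V → O′ r V) →
                ∀ l → Permitted {k} O e l → Permitted O′ e′ l
permitted-map e⊆ f τ        _                     = tt
permitted-map e⊆ f (wr S V) (r , eq , r∈e , good) = r , eq , e⊆ r∈e , f r∈e good
permitted-map e⊆ f (rd S V) (r , eq , r∈e)        = r , eq , e⊆ r∈e

offered-map : (∀ {r V} → r ∈ e → O′ r V → O r V) →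
              ∀ l → Permitted {k} O e l → Offered O′ l → Offered O l
offered-map f τ        _              _                      = tt
offered-map f (wr S V) _              _                      = tt
offered-map f (rd S V) (r , refl , r∈e) (v , _ , refl , good) = v , r , refl , f r∈e good

-- Writes are covariant in the oracle and reads contravariant, hence two inclusions. They are
-- required on `e` only, as permission confines every access to `e`; stratification rests on this
-- locality.
𝓒-map : e ⊆ e′ → (∀ {r V} → r ∈ e → O r V → O′ r V) → (∀ {r V} → r ∈ e → O′ r V → O r V) →
        (∀ {V} → Q V → Q′ V) → ∀ {T} → 𝓒 {k} O e Q T → 𝓒 O′ e′ Q′ T
𝓒-map e⊆ f g q (comp result next) =
  comp (q ∘ result) λ {l} s →
    let p , c = next s in
    permitted-map e⊆ f l p , λ o → 𝓒-map e⊆ f g q (c (offered-map g l p o))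

𝓒-weaken : e ⊆ e′ → (∀ {V} → Q V → Q′ V) → ∀ {T} → 𝓒 {k} O e Q T → 𝓒 O e′ Q′ T
𝓒-weaken e⊆ = 𝓒-map e⊆ (λ _ o → o) (λ _ o → o)

-- Inversion for one layer of an evaluation context: until the hole holds a value, all steps come
-- from the hole. The field `value` has content for `!` only, the one layer that can itself form a
-- value.
record Frame (K : Tm k 0 → Tm k 0) : Set where
  field
    value : ∀ {T} → Val (K T) → Val T
    step  : ∀ {T l U} → K T —[ l ]→ U → Val T ⊎ ∃ λ T′ → T —[ l ]→ T′ × U ≡ K T′

-- The bind of `𝓒`, by induction on the computation in the hole; once a value is there, the
-- continuation answers for all further steps.
𝓒-frame : {K : Tm k 0 → Tm k 0} → Frame K → e₁ ⊆ e →
          (∀ {V} → Val V → Q₁ V → 𝓒 O e Q (K V)) →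
          ∀ {T} → 𝓒 O e₁ Q₁ T → 𝓒 O e Q (K T)
𝓒-frame {K = K} F e⊆ k (comp result next) =
  comp (λ v → let v′ = value v in 𝓒-result (k v′ (result v′)) v) λ {l} s → help l s (step s)
  where
  open Frame F
  help : ∀ l {U} → K _ —[ l ]→ U → Val _ ⊎ (∃ λ T′ → _ —[ l ]→ T′ × U ≡ K T′) → _
  help l s (inj₁ v) = 𝓒-step (k v (result v)) s
  help l s (inj₂ (_ , s′ , refl)) =
    let p , c = next s′ in
    permitted-map e⊆ (λ _ o → o) l p , λ o → 𝓒-frame F e⊆ k (c o)

frame-appˡ : (T : Tm k 0) → Frame (_· T)
frame-appˡ T = record
  { value = λ ()
  ; step  = λ { (β _) → inj₁ (ƛ _) ; (appˡ s) → inj₂ (_ , s , refl) ; (appʳ v _) → inj₁ v } }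

frame-appʳ : {V : Tm k 0} → Val V → Frame (V ·_)
frame-appʳ v = record
  { value = λ ()
  ; step  = λ { (β w) → inj₁ w
              ; (appˡ s) → ⊥-elim (val-stuck v s)
              ; (appʳ _ s) → inj₂ (_ , s , refl) } }

frame-! : Frame {k} !_
frame-! = record
  { value = λ { (! v) → v }
  ; step  = λ { (! s) → inj₂ (_ , s , refl) } }

frame-let! : (T : Tm k 1) → Frame (λ S → let! S T)
frame-let! T = record
  { value = λ ()
  ; step  = λ { (let! v) → inj₁ (! v) ; (let!ˡ s) → inj₂ (_ , s , refl) } }

-- Reads are answered by the oracle, so a step concerns one component and shrinks its derivation
-- alone. The result condition is vacuous, as a parallel composition is never a value.
𝓒-par : e₁ ⊆ e → e₂ ⊆ e → ∀ {S T} → 𝓒 {k} O e₁ Q₁ S → 𝓒 O e₂ Q₂ T → 𝓒 O e Q (S ∥ T)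
𝓒-par-step : e₁ ⊆ e → e₂ ⊆ e → ∀ {S T} → 𝓒 {k} O e₁ Q₁ S → 𝓒 O e₂ Q₂ T →
             ∀ {l U} → S ∥ T —[ l ]→ U → Permitted O e l × (Offered O l → 𝓒 O e Q U)

𝓒-par e₁⊆ e₂⊆ c d = comp (λ ()) (𝓒-par-step e₁⊆ e₂⊆ c d)

𝓒-par-step e₁⊆ e₂⊆ (comp _ next) d {l} (parˡ s) =
  let p , c = next s in permitted-map e₁⊆ (λ _ o → o) l p , λ o → 𝓒-par e₁⊆ e₂⊆ (c o) d
𝓒-par-step e₁⊆ e₂⊆ c (comp _ next) {l} (parʳ s) =
  let p , d = next s in permitted-map e₂⊆ (λ _ o → o) l p , λ o → 𝓒-par e₁⊆ e₂⊆ c (d o)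

-- Interpretation of types.

mutual
  -- The clauses for functions and `!` constrain eliminations only, so the stuck value `*` satisfies
  -- both; free variables can then be closed off by it.
  𝓥 : Oracle k → ValType k → Tm k 0 → Set
  𝓥 O 𝟏            V = ⊤
  𝓥 O (A ⊸[ e ] α) V = ∀ {W} → Val W → 𝓥 O A W → 𝓒 O e (𝓠 O α) (V · W)
  𝓥 O (! A)        V = ∀ {W} → V ≡ ! W → 𝓥 O A W
  𝓥 O (Reg r A)    V = V ≡ reg r

  𝓠 : Oracle k → Type k → Tm k 0 → Set
  𝓠 O 𝐁       V = ⊤
  𝓠 O (val A) V = 𝓥 O A V

-- The regions at which interpreting the type consults the oracle, namely those in latent effects.
-- `Reg` has no constructor because its interpretation is a single constant.
data Uses {k} (r : Fin k) : Type k → Set where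
  lat  : ∀ {A e α} → r ∈ e → Uses r (val (A ⊸[ e ] α))
  arg  : ∀ {A e α} → Uses r (val A) → Uses r (val (A ⊸[ e ] α))
  res  : ∀ {A e α} → Uses r α → Uses r (val (A ⊸[ e ] α))
  !_   : ∀ {A} → Uses r (val A) → Uses r (val (! A))

infix 4 _≈[_]_
_≈[_]_ : Oracle k → Type k → Oracle k → Set
O ≈[ α ] O′ = ∀ {r} → Uses r α → ∀ {V} → (O r V → O′ r V) × (O′ r V → O r V)

mutual
  -- The oracle enters only through `𝓒` at a latent effect, where `𝓒-map` asks for agreement on that
  -- effect alone.
  𝓥-cong : ∀ A → O ≈[ val A ] O′ → ∀ {V} → 𝓥 {k} O A V → 𝓥 O′ A V
  𝓥-cong 𝟏            h v = tt
  𝓥-cong (A ⊸[ e ] α) h f w a =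
    𝓒-map id (λ r∈e → proj₁ (h (lat r∈e))) (λ r∈e → proj₂ (h (lat r∈e)))
      (𝓠-cong α (λ u → h (res u)))
      (f w (𝓥-cong A (λ u → let to , from = h (arg u) in from , to) a))
  𝓥-cong (! A)        h f eq = 𝓥-cong A (λ u → h (! u)) (f eq)
  𝓥-cong (Reg r A)    h v = v

  𝓠-cong : ∀ α → O ≈[ α ] O′ → ∀ {V} → 𝓠 {k} O α V → 𝓠 O′ α V
  𝓠-cong 𝐁       h v = tt
  𝓠-cong (val A) h v = 𝓥-cong A h v

𝓠-≤ : ∀ {R : RegCtx k} {α α′} → R ⊢ α ≤ α′ → ∀ {V} → 𝓠 O α V → 𝓠 O α′ V
𝓠-≤ refl v = v
𝓠-≤ (! h) f eq = 𝓠-≤ h (f eq)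
𝓠-≤ (fun e⊆e′ _ h h′) f w a = 𝓒-weaken e⊆e′ (𝓠-≤ h′) (f w (𝓠-≤ h a))

-- Simulation of reduction and transfer of termination.

ECtx-focus : {σ : Fin n → Tm k 0} → (∀ x → Val (σ x)) → (E : ECtx n) → ∀ {M T} →
  Erases G σ (E ⟦ M ⟧) T → ∃ λ S → Erases G σ M S ×
  (∀ {l M′ S′} → S —[ l ]→ S′ → Erases G σ M′ S′ →
   ∃ λ T′ → T —[ l ]→ T′ × Erases G σ (E ⟦ M′ ⟧) T′)
ECtx-focus h □ a = _ , a , λ s a′ → _ , s , a′
ECtx-focus h (appˡ E _) (a · b) with ECtx-focus h E a
... | _ , c , plug = _ , c , λ s c′ → let _ , s′ , a′ = plug s c′ in _ , appˡ s′ , a′ · b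
ECtx-focus h (appʳ v E) (a · b) with ECtx-focus h E b
... | _ , c , plug = _ , c , λ s c′ →
  let _ , s′ , b′ = plug s c′ in _ , appʳ (erased-value h v a) s′ , a · b′
ECtx-focus h (! E) (! a) with ECtx-focus h E a
... | _ , c , plug = _ , c , λ s c′ → let _ , s′ , a′ = plug s c′ in _ , ! s′ , ! a′
ECtx-focus h (let! E _) (let! a b) with ECtx-focus h E a
... | _ , c , plug = _ , c , λ s c′ → let _ , s′ , a′ = plug s c′ in _ , let!ˡ s′ , let! a′ b

-- The part of `Permitted` that lets the store created by a write be erased.
WritesStored : Oracle k → Tm k 0 → Set
WritesStored O T = ∀ {S V T′} → T —[ wr S V ]→ T′ → Stored O S V

-- A volatile store consumed by a read leaves a * behind in U, and a store
-- created by a write is a * missing from U: hence ⊒.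
Simulates : Oracle k → Exp n → Exp n → Set
Simulates {k} {n} O P P′ =
  ∀ {σ : Fin n → Tm k 0} → (∀ x → Val (σ x)) →
  ∀ {T} → WritesStored O T → Erases (Stored O) σ P T →
  ∃ λ l → ∃₂ λ U T′ → T —[ l ]→ U × Offered O l × U ⊒ T′ × Erases (Stored O) σ P′ T′

↦-simulates : {Q Q′ : Exp n} → Q ↦ Q′ → Simulates {k} O Q Q′
↦-simulates (β E v) h w a with ECtx-focus h E a
... | _ , ƛ m · b , plug =
  let _ , s , a′ = plug (β (erased-value h v b)) (erase-[] m v b)
  in _ , _ , _ , s , tt , refl , a′
↦-simulates (let! E v) h w a with ECtx-focus h E a
... | _ , let! (! b) m , plug =
  let _ , s , a′ = plug (let! (erased-value h v b)) (erase-[] m v b)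
  in _ , _ , _ , s , tt , refl , a′
↦-simulates (set E v) h w a with ECtx-focus h E a
... | _ , set x b , plug =
  let _ , s , a′ = plug set * in _ , _ , _ , s , tt , pad , a′ ∥ st← x b (w s)
↦-simulates (pset E v) h w a with ECtx-focus h E a
... | _ , pset x b , plug =
  let _ , s , a′ = plug set * in _ , _ , _ , s , tt , pad , a′ ∥ st⇐ x b (w s)
↦-simulates (get← E v) h w (a ∥ st← (var refl) b g) with ECtx-focus h E a
... | _ , get (var refl) , plug =
  -- The calculus lets `get` return any term; the erased content of the store is chosen, and `g`
  -- certifies that the oracle offers it.
  let _ , s , a′ = plug get b
  in _ , _ , _ , parˡ s , (erased-value h v b , g) , drop , a′
↦-simulates (get⇐ E v) h w (a ∥ st⇐ (var refl) b g) with ECtx-focus h E a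
... | _ , get (var refl) , plug =
  let _ , s , a′ = plug get b
  in _ , _ , _ , parˡ s , (erased-value h (! v) b , g) , refl , a′ ∥ st⇐ (var refl) b g

static-simulates : ∀ {m n} {Q Q′ : Exp m} (C : SCtx m n) →
                   Simulates {k} O Q Q′ → Simulates O (C ⟪ Q ⟫) (C ⟪ Q′ ⟫)
static-simulates □ f = f
static-simulates (parˡ C _) f h w (a ∥ b) with static-simulates C f h (λ s → w (parˡ s)) a
... | _ , _ , _ , s , o , g , a′ = _ , _ , _ , parˡ s , o , cong-∥ g refl , a′ ∥ b
static-simulates (parʳ _ C) f h w (a ∥ b) with static-simulates C f h (λ s → w (parʳ s)) b
... | _ , _ , _ , s , o , g , b′ = _ , _ , _ , parʳ s , o , cong-∥ refl g , a ∥ b′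
static-simulates (ν C) f h w (ν r a)
  with static-simulates C f (λ { zero → reg r ; (suc x) → h x }) w a
... | _ , _ , _ , s , o , g , a′ = _ , _ , _ , s , o , g , ν r a′

-- Induction on the computability of `S`, which need only dominate the erasure of `P`: structural
-- equivalence lengthens `⊒`, while each basic reduction costs `S` one offered step.
𝓒-terminating : {σ : Fin n → Tm k 0} → (∀ x → Val (σ x)) → ∀ {P S T} →
                𝓒 O e Q S → S ⊒ T → Erases (Stored O) σ P T → Terminating P
𝓒-terminating {O = O} h {P} {S} c@(comp _ next) S⊒T a = acc λ { (red C P≋ q ≋P′) → go C P≋ q ≋P′ }
  where
  go : ∀ {m P′} {Q Q′ : Exp m} (C : SCtx m _) →
       P ≋ C ⟪ Q ⟫ → Q ↦ Q′ → C ⟪ Q′ ⟫ ≋ P′ → Terminating P′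
  go C P≋ q ≋P′ =
    let T₁ , a₁ , T⊒T₁ = proj₁ (≋-transfers P≋) a
        S⊒T₁ = trans S⊒T T⊒T₁
        -- Each write of `T₁` is also one of `S`, whose permission supplies the condition.
        stored : WritesStored O T₁
        stored s = let _ , s′ , _ = ⊒-simulates S⊒T₁ s
                       (r , eq , _ , good) , _ = next s′
                   in r , eq , good
        _ , _ , _ , s , o , U⊒T₂ , a₂ = static-simulates C (↦-simulates q) h stored a₁
        _ , s′ , S′⊒U = ⊒-simulates S⊒T₁ s
        _ , a₃ , T₂⊒T₃ = proj₁ (≋-transfers ≋P′) a₂
    in 𝓒-terminating h (proj₂ (next s′) o) (trans S′⊒U (trans U⊒T₂ T₂⊒T₃)) a₃

-- Inclusion of contexts up to usages.

-- Stated for functions rather than vectors, which unification can then infer.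
infix 4 _⊑_
_⊑_ : {B : Set} → (f g : Fin n → Maybe (B × ValType k)) → Set
f ⊑ g = ∀ x {b A} → f x ≡ just (b , A) → ∃ λ b′ → g x ≡ just (b′ , A)

⊑-trans : {B : Set} {f g h : Fin n → Maybe (B × ValType k)} → f ⊑ g → g ⊑ h → f ⊑ h
⊑-trans f⊑g g⊑h x = g⊑h x ∘ proj₂ ∘ f⊑g x

module _ {f g h : Fin n → Maybe (RegHyp k)} (sum : ∀ r → RegSum (f r) (g r) (h r)) where

  ⊎ᴿ-⊑ˡ : f ⊑ h
  ⊎ᴿ-⊑ˡ r eq with f r | g r | h r | sum r
  ⊎ᴿ-⊑ˡ r refl | _ | _ | _ | left _ = _ , refl
  ⊎ᴿ-⊑ˡ r refl | _ | _ | _ | both _ = _ , refl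

  ⊎ᴿ-⊑ʳ : g ⊑ h
  ⊎ᴿ-⊑ʳ r eq with f r | g r | h r | sum r
  ⊎ᴿ-⊑ʳ r refl | _ | _ | _ | right _ = _ , refl
  ⊎ᴿ-⊑ʳ r refl | _ | _ | _ | both _  = _ , refl

module _ {f g h : Fin n → Maybe (VarHyp k)} (sum : ∀ x → VarSum (f x) (g x) (h x)) where

  ⊎ⱽ-⊑ˡ : f ⊑ h
  ⊎ⱽ-⊑ˡ x eq with f x | g x | h x | sum x
  ⊎ⱽ-⊑ˡ x refl | _ | _ | _ | left   = _ , refl
  ⊎ⱽ-⊑ˡ x refl | _ | _ | _ | both _ = _ , refl

  ⊎ⱽ-⊑ʳ : g ⊑ h
  ⊎ⱽ-⊑ʳ x eq with f x | g x | h x | sum x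
  ⊎ⱽ-⊑ʳ x refl | _ | _ | _ | right  = _ , refl
  ⊎ⱽ-⊑ʳ x refl | _ | _ | _ | both _ = _ , refl

⊢ᵀ-Reg : ∀ {R : RegCtx k} {r A} → R ⊢ᵀ val (Reg r A) → R ⊢ × ∃ λ U → R ∋ r ⦂ (U , A)
⊢ᵀ-Reg (Reg w R∋r) = w , _ , R∋r

dom-lookup : ∀ (R : RegCtx k) {r} → r ∈ dom R → ∃ λ h → R ∋ r ⦂ h
dom-lookup R {r} r∈ with lookup R r | ≡.trans (≡.sym (lookup-map r is-just R)) ([]=⇒lookup r∈)
... | just h | _ = h , refl

uses-dom : ∀ {R : RegCtx k} {α r} → R ⊢ᵀ α → Uses r α → r ∈ dom R
uses-dom (! w)        (! u)   = uses-dom w u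
uses-dom (fun _ _ e⊆) (lat i) = e⊆ i
uses-dom (fun w _ _)  (arg u) = uses-dom w u
uses-dom (fun _ w _)  (res u) = uses-dom w u

-- The oracle of a stratified region context.

module Stratified {k : ℕ} (R₀ : RegCtx k) where

  infix 4 _≺_
  -- Interpreting the content of `r` consults the oracle at `s`.
  _≺_ : Fin k → Fin k → Set
  s ≺ r = ∃₂ λ U A → R₀ ∋ r ⦂ (U , A) × Uses s (val A)

  ext-⊑ : ∀ R {r h} → lookup R r ≡ nothing →
          lookup (R [ r ]≔ just h) ⊑ lookup R₀ → lookup R ⊑ lookup R₀
  ext-⊑ R {r} new R⊑ s R∋s with s ≟ r
  ... | no  s≢r  = R⊑ s (≡.trans (lookup∘update′ s≢r R _) R∋s)
  ... | yes refl with () ← ≡.trans (≡.sym new) R∋s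

  mutual
    -- Induction on formation: the type of the region introduced last uses only regions of the
    -- smaller context. The relation stays that of `R₀` while `R` shrinks.
    ⊢⇒acc : ∀ {R} → R ⊢ → lookup R ⊑ lookup R₀ → ∀ {r h} → R ∋ r ⦂ h → Acc _≺_ r
    ⊢⇒acc ∅ _ {r} R∋r with () ← ≡.trans (≡.sym (lookup-replicate r nothing)) R∋r
    ⊢⇒acc (ext {R} {r₀} w new) R⊑ {r} R∋r with r ≟ r₀
    ... | no  r≢r₀ = ⊢ᵀ⇒acc w (ext-⊑ R new R⊑) (≡.trans (≡.sym (lookup∘update′ r≢r₀ R _)) R∋r)
    ... | yes refl = acc λ where
      -- The inclusion in `R₀` identifies the type recorded there with the one just introduced.
      (_ , _ , R₀∋r , u) → case ≡.trans (≡.sym (proj₂ (R⊑ r₀ (lookup∘update r₀ R _)))) R₀∋r of λ where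
        refl → ⊢ᵀ⇒acc w (ext-⊑ R new R⊑) (proj₂ (dom-lookup R (uses-dom w u)))

    ⊢ᵀ⇒acc : ∀ {R α} → R ⊢ᵀ α → lookup R ⊑ lookup R₀ → ∀ {r h} → R ∋ r ⦂ h → Acc _≺_ r
    ⊢ᵀ⇒acc (𝟏 w)       = ⊢⇒acc w
    ⊢ᵀ⇒acc (𝐁 w)       = ⊢⇒acc w
    ⊢ᵀ⇒acc (! w)       = ⊢ᵀ⇒acc w
    ⊢ᵀ⇒acc (fun w _ _) = ⊢ᵀ⇒acc w
    ⊢ᵀ⇒acc (Reg w _)   = ⊢⇒acc w

  -- Recursion on accessibility supplies the oracle below `r` only and leaves it empty elsewhere; by
  -- `𝓥-cong` this determines the interpretation, since every region used by the type of `r` is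
  -- below `r`.
  𝓡 : ∀ {r} → Acc _≺_ r → Tm k 0 → Set
  𝓡 {r} (acc below) V = ∃₂ λ U A → R₀ ∋ r ⦂ (U , A) ×
    𝓥 (λ s W → Σ (s ≺ r) λ s≺r → 𝓡 (below s≺r) W) A V

  𝓡-irrelevant : ∀ {r} (a a′ : Acc _≺_ r) {V} → 𝓡 a V → 𝓡 a′ V
  𝓡-irrelevant (acc below) (acc below′) (_ , A , R₀∋r , v) = _ , A , R₀∋r ,
    𝓥-cong A (λ _ → (λ { (s≺r , w) → s≺r , 𝓡-irrelevant (below s≺r) (below′ s≺r) w }) ,
                    (λ { (s≺r , w) → s≺r , 𝓡-irrelevant (below′ s≺r) (below s≺r) w })) v

  -- R₀ is not assumed to be stratified: the rules check this only where the
  -- variable context is nonempty.  Regions that are not accessible hold no value.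
  𝓞 : Oracle k
  𝓞 r V = Σ (Acc _≺_ r) λ a → 𝓡 a V

  -- With `𝓥⇒𝓞`, the fixed-point equation of the oracle: on accessible regions of `R₀`, it
  -- interprets the type of `r` relative to itself.
  𝓞⇒𝓥 : ∀ {r U A V} → R₀ ∋ r ⦂ (U , A) → 𝓞 r V → 𝓥 𝓞 A V
  𝓞⇒𝓥 R₀∋r (acc below , _ , A , R₀∋r′ , v) with refl ← ≡.trans (≡.sym R₀∋r) R₀∋r′ =
    𝓥-cong A (λ u → (λ { (s≺r , w) → below s≺r , w }) ,
                    (λ { (a , w) → let s≺r = _ , _ , R₀∋r , u in
                                   s≺r , 𝓡-irrelevant a (below s≺r) w })) v

  𝓥⇒𝓞 : ∀ {r U A V} → Acc _≺_ r → R₀ ∋ r ⦂ (U , A) → 𝓥 𝓞 A V → 𝓞 r V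
  𝓥⇒𝓞 {A = A} (acc below) R₀∋r v = acc below , _ , A , R₀∋r ,
    𝓥-cong A (λ u → (λ { (a , w) → let s≺r = _ , _ , R₀∋r , u in
                                   s≺r , 𝓡-irrelevant a (below s≺r) w }) ,
                    (λ { (s≺r , w) → below s≺r , w })) v

  -- Soundness of typing.

  module Soundness (durability : Fin k → Durability) where
    open TypeSystem durability

    infix 4 _⊩_
    record _⊩_ (Γ : VarCtx k n) (σ : Fin n → Tm k 0) : Set where
      field
        values : ∀ x → Val (σ x)
        typed  : ∀ {x u A} → Γ ∋ x ⦂ (u , A) → 𝓥 𝓞 A (σ x)
    open _⊩_

    ⊩-∙ : ∀ {Γ : VarCtx k n} {σ V u A} → Γ ⊩ σ → Val V → 𝓥 𝓞 A V → just (u , A) ∷ Γ ⊩ V ∙ σ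
    ⊩-∙ env v a .values zero    = v
    ⊩-∙ env v a .values (suc x) = env .values x
    ⊩-∙ env v a .typed {zero} refl = a
    ⊩-∙ env v a .typed {suc x} Γ∋x = env .typed Γ∋x

    ⊩-⊑ : ∀ {Γ₁ Γ : VarCtx k n} {σ} → lookup Γ₁ ⊑ lookup Γ → Γ ⊩ σ → Γ₁ ⊩ σ
    ⊩-⊑ h env .values     = env .values
    ⊩-⊑ h env .typed Γ₁∋x = env .typed (proj₂ (h _ Γ₁∋x))

    -- The open erasure `T` is fixed before `σ`, because the regions chosen for the ν's below an
    -- abstraction must be the same for every argument.
    Sound : VarCtx k n → Exp n → Type k × Effect k → Set
    Sound {n} Γ M (α , e) = ∃ λ (T : Tm k n) → Erases NoStore var M T ×
      (∀ {σ} → Γ ⊩ σ → 𝓒 𝓞 e (𝓠 𝓞 α) (subs σ T))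

    -- The region is accessible because forming the type `Reg r A` of the address presupposes a
    -- stratified context.
    write-stored : ∀ {d R R′ x r A V σ} {Γ Γ′ : VarCtx k n} → WritePremises d R Γ x r A R′ Γ′ →
                   lookup R ⊑ lookup R₀ → Γ ⊩ σ → 𝓥 𝓞 A V → σ x ≡ reg r × 𝓞 r V
    write-stored {x = x} prem R⊑ env a =
      let open WritePremises prem
          _ , Γ∋x     = ⊎ⱽ-⊑ˡ split-Γ x (lookup∘update x (replicate _ nothing) _)
          w , _ , R∋r = ⊢ᵀ-Reg (well-formed Γ∋x)
      in env .typed Γ∋x , 𝓥⇒𝓞 (⊢⇒acc w R⊑ R∋r) (proj₂ (R⊑ _ R∋r)) a

    get-sound : ∀ {r U A} → R₀ ∋ r ⦂ (U , A) → 𝓒 𝓞 ⁅ r ⁆ (𝓥 𝓞 A) (get (reg r))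
    get-sound {r} R₀∋r = comp (λ ()) λ where
      get → (r , refl , x∈⁅x⁆ r) , λ { (v , _ , refl , good) → 𝓒-val v (𝓞⇒𝓥 R₀∋r good) }

    set-sound : ∀ {r V} → 𝓞 r V → 𝓒 𝓞 ⁅ r ⁆ (𝓥 𝓞 𝟏) (set (reg r) V)
    set-sound {r} good = comp (λ ()) λ where
      set → (r , refl , x∈⁅x⁆ r , good) , λ _ → 𝓒-val * tt

    ƛ-sound : ∀ {T A e α} → (∀ {V} → Val V → 𝓥 𝓞 A V → 𝓒 𝓞 e (𝓠 𝓞 α) (T ⟨ V ⟩)) →
              𝓥 𝓞 (A ⊸[ e ] α) (ƛ T)
    ƛ-sound body w a = comp (λ ()) λ where
      (β _)      → tt , λ _ → body w a
      (appʳ _ s) → ⊥-elim (val-stuck w s)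

    app-sound : ∀ {S T A e e′ e″ α} → 𝓒 𝓞 e′ (𝓥 𝓞 (A ⊸[ e ] α)) S → 𝓒 𝓞 e″ (𝓥 𝓞 A) T →
                𝓒 𝓞 (e ∪ e′ ∪ e″) (𝓠 𝓞 α) (S · T)
    app-sound {T = T} {e = e} {e′} {e″} c d =
      𝓒-frame (frame-appˡ T) (q⊆p∪q e _ ∘ p⊆p∪q e″)
        (λ v f → 𝓒-frame (frame-appʳ v) (q⊆p∪q e _ ∘ q⊆p∪q e′ e″)
          (λ w a → 𝓒-weaken (p⊆p∪q (e′ ∪ e″)) id (f w a)) d) c

    let!-sound : ∀ {S T A e e′ α} → 𝓒 𝓞 e (𝓥 𝓞 (! A)) S →
                 (∀ {V} → Val V → 𝓥 𝓞 A V → 𝓒 𝓞 e′ (𝓠 𝓞 α) (T ⟨ V ⟩)) →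
                 𝓒 𝓞 (e ∪ e′) (𝓠 𝓞 α) (let! S T)
    let!-sound {T = T} {e = e} {e′} c body =
      𝓒-frame (frame-let! T) (p⊆p∪q e′)
        (λ v f → comp (λ ()) λ where
          (let! w)  → tt , λ _ → 𝓒-weaken (q⊆p∪q e e′) id (body w (f refl))
          (let!ˡ s) → ⊥-elim (val-stuck v s)) c

    -- Induction on typing. Splittings of contexts turn into inclusions, so a single oracle over
    -- `R₀` serves all subderivations.
    term-sound : ∀ {R M α e} {Γ : VarCtx k n} → lookup R ⊑ lookup R₀ → Term M →
                 R ⨾ Γ ⊢ M ⦂ (α , e) → Sound Γ M (α , e)
    term-sound R⊑ _ (var {x} _ Γ∋x) =
      var x , var refl , λ env → 𝓒-val (env .values x) (env .typed Γ∋x)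
    term-sound R⊑ _ (* _) = * , * , λ _ → 𝓒-val * tt
    term-sound R⊑ (val (ƛ m)) (ƛ {α = α} d) =
      let T , a , c = term-sound R⊑ m d in
      -- The environments `var` and `lift var` agree only pointwise.
      ƛ T , ƛ (erase-cong (λ { zero → refl ; (suc _) → refl }) a) , λ {σ} env →
      𝓒-val (ƛ _) (ƛ-sound {α = α} λ {V} v b →
        ≡.subst (𝓒 _ _ _) (≡.sym (lift-⟨⟩ σ V T)) (c (⊩-∙ env v b)))
    term-sound R⊑ (m · n) (app {α = α} sumR sumΓ d d′) =
      let S , a , c  = term-sound (⊑-trans (⊎ᴿ-⊑ˡ sumR) R⊑) m d
          T , a′ , c′ = term-sound (⊑-trans (⊎ᴿ-⊑ʳ sumR) R⊑) n d′
      in S · T , a · a′ , λ env →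
      app-sound {α = α} (c (⊩-⊑ (⊎ⱽ-⊑ˡ sumΓ) env)) (c′ (⊩-⊑ (⊎ⱽ-⊑ʳ sumΓ) env))
    term-sound R⊑ m (bang sumR sumΓ _ _ d _) =
      let T , a , c = term-sound (⊑-trans (⊎ᴿ-⊑ˡ sumR) R⊑) (unbang m) d in
      ! T , ! a , λ env →
      𝓒-frame frame-! id (λ v b → 𝓒-val (! v) λ { refl → b }) (c (⊩-⊑ (⊎ⱽ-⊑ˡ sumΓ) env))
      where
      unbang : ∀ {M} → Term (! M) → Term M
      unbang (val (! v)) = val v
      unbang (! m)       = m
    term-sound R⊑ (let! m n) (let! {α = α} sumR sumΓ d d′) =
      let S , a , c  = term-sound (⊑-trans (⊎ᴿ-⊑ˡ sumR) R⊑) m d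
          T , a′ , c′ = term-sound (⊑-trans (⊎ᴿ-⊑ʳ sumR) R⊑) n d′
      in let! S T , let! a (erase-cong (λ { zero → refl ; (suc _) → refl }) a′) , λ {σ} env →
      let!-sound {α = α} (c (⊩-⊑ (⊎ⱽ-⊑ˡ sumΓ) env)) λ {V} v b →
        ≡.subst (𝓒 _ _ _) (≡.sym (lift-⟨⟩ σ V T)) (c′ (⊩-∙ (⊩-⊑ (⊎ⱽ-⊑ʳ sumΓ) env) v b))
    term-sound R⊑ (ν m) (ν {r = r} d) =
      let T , a , c = term-sound R⊑ m d in
      -- The region is read off the type that the derivation gives to the bound variable.
      T ⟨ reg r ⟩ , ν r (erase-sub (λ _ → refl) a) , λ env →
      ≡.subst (𝓒 _ _ _) (≡.sym (sub-sub (λ { zero → refl ; (suc _) → refl }) T))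
        (c (⊩-∙ env (reg r) refl))
    term-sound R⊑ _ (get {x} {r = r} _ Γ∋x R∋r _) =
      get (var x) , get (var refl) , λ env →
      ≡.subst (λ S → 𝓒 _ _ _ (get S)) (≡.sym (env .typed Γ∋x)) (get-sound (proj₂ (R⊑ _ R∋r)))
    term-sound R⊑ (set x v) (set prem d) =
      let T , a , c = term-sound (⊑-trans (⊎ᴿ-⊑ʳ (WritePremises.split-R prem)) R⊑) (val v) d in
      set (var x) T , set (var refl) a , λ {σ} env →
      -- The content is a syntactic value, so its erasure is a `Val` and its computability yields
      -- membership in `𝓥` at once.
      let V-val = erased-value {G = NoStore} (env .values) v (erase-sub (λ _ → refl) a)
          eq , good = write-stored prem R⊑ env
                        (𝓒-result (c (⊩-⊑ (⊎ⱽ-⊑ʳ (WritePremises.split-Γ prem)) env)) V-val)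
      in ≡.subst (λ S → 𝓒 _ _ _ (set S (subs σ T))) (≡.sym eq) (set-sound good)
    term-sound R⊑ (pset x v) (pset prem d) =
      let T , a , c = term-sound (⊑-trans (⊎ᴿ-⊑ʳ (WritePremises.split-R prem)) R⊑) (val v) d in
      set (var x) T , pset (var refl) a , λ {σ} env →
      let V-val = erased-value {G = NoStore} (env .values) v (erase-sub (λ _ → refl) a)
          eq , good = write-stored prem R⊑ env
                        (𝓒-result (c (⊩-⊑ (⊎ⱽ-⊑ʳ (WritePremises.split-Γ prem)) env)) V-val)
      in ≡.subst (λ S → 𝓒 _ _ _ (set S (subs σ T))) (≡.sym eq) (set-sound good)
    term-sound R⊑ (m ∥ n) (par-store sumR sumΓ d d′ _) =
      let S , a , c  = term-sound (⊑-trans (⊎ᴿ-⊑ˡ sumR) R⊑) m d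
          T , a′ , c′ = term-sound (⊑-trans (⊎ᴿ-⊑ʳ sumR) R⊑) n d′
      in S ∥ T , a ∥ a′ , λ env →
      𝓒-par id ⊥⊆ (c (⊩-⊑ (⊎ⱽ-⊑ˡ sumΓ) env)) (c′ (⊩-⊑ (⊎ⱽ-⊑ʳ sumΓ) env))
    term-sound R⊑ (m ∥ n) (store-par sumR sumΓ d _ d′) =
      let S , a , c  = term-sound (⊑-trans (⊎ᴿ-⊑ˡ sumR) R⊑) m d
          T , a′ , c′ = term-sound (⊑-trans (⊎ᴿ-⊑ʳ sumR) R⊑) n d′
      in S ∥ T , a ∥ a′ , λ env →
      𝓒-par ⊥⊆ id (c (⊩-⊑ (⊎ⱽ-⊑ˡ sumΓ) env)) (c′ (⊩-⊑ (⊎ⱽ-⊑ʳ sumΓ) env))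
    term-sound R⊑ (m ∥ n) (par {e₁ = e₁} {e₂} sumR sumΓ d _ d′ _) =
      let S , a , c  = term-sound (⊑-trans (⊎ᴿ-⊑ˡ sumR) R⊑) m d
          T , a′ , c′ = term-sound (⊑-trans (⊎ᴿ-⊑ʳ sumR) R⊑) n d′
      in S ∥ T , a ∥ a′ , λ env →
      𝓒-par (p⊆p∪q e₂) (q⊆p∪q e₁ e₂) (c (⊩-⊑ (⊎ⱽ-⊑ˡ sumΓ) env)) (c′ (⊩-⊑ (⊎ⱽ-⊑ʳ sumΓ) env))
    term-sound R⊑ m (subsume _ d (sub e⊆ _ α≤)) =
      let T , a , c = term-sound R⊑ m d in T , a , λ env → 𝓒-weaken e⊆ (𝓠-≤ α≤) (c env)
    term-sound R⊑ (val ()) (store← _ _)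
    term-sound R⊑ (val ()) (store⇐ _ _)

    ∥-program : ∀ {P Q : Exp n} → Program (P ∥ Q) → Program P × Program Q
    ∥-program (term (m ∥ n))  = term m , term n
    ∥-program (store (s ∥ t)) = store s , store t
    ∥-program (p ∥ q)         = p , q

    -- Unlike in `Sound`, the environment comes first: stores occur here, and their condition
    -- concerns closed terms.
    program-sound : ∀ {R P α e σ} {Γ : VarCtx k n} → lookup R ⊑ lookup R₀ → Program P →
                    R ⨾ Γ ⊢ P ⦂ (α , e) → Γ ⊩ σ →
                    ∃ λ T → Erases (Stored 𝓞) σ P T × 𝓒 𝓞 e (𝓠 𝓞 α) T
    program-sound {σ = σ} R⊑ (term m) d env =
      let T , a , c = term-sound R⊑ m d in subs σ T , erase-sub (λ _ → refl) a , c env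
    program-sound R⊑ p (subsume _ d (sub e⊆ _ α≤)) env =
      let T , a , c = program-sound R⊑ p d env in T , a , 𝓒-weaken e⊆ (𝓠-≤ α≤) c
    program-sound R⊑ (ν p) (ν {r = r} d) env =
      let T , a , c = program-sound R⊑ p d (⊩-∙ env (reg r) refl) in T , ν r a , c
    program-sound R⊑ (store (x ← v)) (store← {r = r} prem d) env =
      let T , a , c = program-sound (⊑-trans (⊎ᴿ-⊑ʳ (WritePremises.split-R prem)) R⊑)
                        (term (val v)) d (⊩-⊑ (⊎ⱽ-⊑ʳ (WritePremises.split-Γ prem)) env)
          stored = write-stored prem R⊑ env (𝓒-result c (erased-value (env .values) v a))
      in * , st← (var refl) a (r , stored) , 𝓒-val * tt
    program-sound R⊑ (store (x ⇐ v)) (store⇐ {r = r} prem d) env =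
      let T , a , c = program-sound (⊑-trans (⊎ᴿ-⊑ʳ (WritePremises.split-R prem)) R⊑)
                        (term (val v)) d (⊩-⊑ (⊎ⱽ-⊑ʳ (WritePremises.split-Γ prem)) env)
          stored = write-stored prem R⊑ env (𝓒-result c (erased-value (env .values) v a))
      in * , st⇐ (var refl) a (r , stored) , 𝓒-val * tt
    program-sound R⊑ pq (par-store sumR sumΓ d d′ _) env =
      let p , q = ∥-program pq
          S , a  , c  = program-sound (⊑-trans (⊎ᴿ-⊑ˡ sumR) R⊑) p d  (⊩-⊑ (⊎ⱽ-⊑ˡ sumΓ) env)
          T , a′ , c′ = program-sound (⊑-trans (⊎ᴿ-⊑ʳ sumR) R⊑) q d′ (⊩-⊑ (⊎ⱽ-⊑ʳ sumΓ) env)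
      in S ∥ T , a ∥ a′ , 𝓒-par id ⊥⊆ c c′
    program-sound R⊑ pq (store-par sumR sumΓ d _ d′) env =
      let p , q = ∥-program pq
          S , a  , c  = program-sound (⊑-trans (⊎ᴿ-⊑ˡ sumR) R⊑) p d  (⊩-⊑ (⊎ⱽ-⊑ˡ sumΓ) env)
          T , a′ , c′ = program-sound (⊑-trans (⊎ᴿ-⊑ʳ sumR) R⊑) q d′ (⊩-⊑ (⊎ⱽ-⊑ʳ sumΓ) env)
      in S ∥ T , a ∥ a′ , 𝓒-par ⊥⊆ id c c′
    program-sound R⊑ pq (par {e₁ = e₁} {e₂} sumR sumΓ d _ d′ _) env =
      let p , q = ∥-program pq
          S , a  , c  = program-sound (⊑-trans (⊎ᴿ-⊑ˡ sumR) R⊑) p d  (⊩-⊑ (⊎ⱽ-⊑ˡ sumΓ) env)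
          T , a′ , c′ = program-sound (⊑-trans (⊎ᴿ-⊑ʳ sumR) R⊑) q d′ (⊩-⊑ (⊎ⱽ-⊑ʳ sumΓ) env)
      in S ∥ T , a ∥ a′ , 𝓒-par (p⊆p∪q e₂) (q⊆p∪q e₁ e₂) c c′

    -- Closing the free variables.

    -- Free variables of type other than Reg r A become *, which is stuck in every
    -- position that would eliminate it.
    inhabitant : ValType k → Tm k 0
    inhabitant (Reg r _) = reg r
    inhabitant _         = *

    inhabitant-val : ∀ A → Val (inhabitant A)
    inhabitant-val 𝟏            = *
    inhabitant-val (_ ⊸[ _ ] _) = *
    inhabitant-val (! _)        = *
    inhabitant-val (Reg r _)    = reg r

    inhabitant-𝓥 : ∀ A → 𝓥 𝓞 A (inhabitant A)
    inhabitant-𝓥 𝟏            = tt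
    inhabitant-𝓥 (A ⊸[ e ] α) w _ = comp (λ ()) λ { (appʳ _ s) → ⊥-elim (val-stuck w s) }
    inhabitant-𝓥 (! A)        = λ ()
    inhabitant-𝓥 (Reg r A)    = refl

    canonical : VarCtx k n → Fin n → Tm k 0
    canonical Γ x with lookup Γ x
    ... | just (_ , A) = inhabitant A
    -- Outside the domain of `Γ` any value would do.
    ... | nothing      = *

    ⊩-canonical : (Γ : VarCtx k n) → Γ ⊩ canonical Γ
    ⊩-canonical Γ .values x with lookup Γ x
    ... | just (_ , A) = inhabitant-val A
    ... | nothing      = *
    ⊩-canonical Γ .typed {x} Γ∋x with lookup Γ x
    ⊩-canonical Γ .typed {A = A} refl | _ = inhabitant-𝓥 A

theorem2 : ∀ (k n : ℕ) (durability : Fin k → Durability) →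
    let open TypeSystem durability in
    ∀ (R : RegCtx k) (Γ : VarCtx k n) (P : Exp n) (α : Type k) (e : Effect k) →
    Program P →
    R ⨾ Γ ⊢ P ⦂ (α , e) →
    Terminating P
theorem2 k n durability R Γ P α e p d =
  -- The given `R` serves as `R₀`, so the required inclusion is reflexivity.
  let open Stratified.Soundness R durability
      env = ⊩-canonical Γ
      _ , a , c = program-sound (λ _ R∋r → _ , R∋r) p d env
  in 𝓒-terminating (_⊩_.values env) c refl a
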